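{- Let $p(x)$ be a partial type over a set $A$. The following are equivalent: (a) $p$ is supersimple; (b) there is a forking rank ranking all types in $\langle p\rangle$; (c) there is a dividing rank ranking all types in $\langle p\rangle$.
   Context: $T$ is a complete first-order theory with a monster model $\mathfrak C$ (sufficiently saturated and strongly homogeneous); all parameter sets are small subsets of $\mathfrak C$. Complete types are finitary; $S(A)$ is the set of complete types over $A$. A class of complete types is a class $\mathfrak A$ of complete types closed under complete extensions (if $p(x)\in\mathfrak A$ and $q(x)\supseteq p(x)$ is complete, then $q\in\mathfrak A$) and under conjugation by automorphisms of $\mathfrak C$. For a partial type $p$ over $A$, $\langle p\rangle$ is the smallest class of complete types (in this sense) containing all completions $q\in S(A)$ of $p$. A rank on $\mathfrak A$ is a mapping $R:\mathfrak A\to\mathrm{Ord}\cup\{\infty\}$ with Heredity ($p\subseteq q$ implies $R(p)\ge R(q)$) and Isomorphism ($R(p)=R(p^f)$ for all $f\in Aut(\mathfrak C)$). $R$ ranks $p$ if $R(p)<\infty$. $R$ is a dividing (resp. forking) rank if for all $p\in S(A)$, $q\in S(B)$ in $\mathfrak A$ with $p\subseteq q$, $p$ ranked, and $q$ dividing (resp. forking) over $A$, one has $R(p)>R(q)$. $a\mathop{\smile\hspace{ -0.9em}|}^d_C B$, written with $\mathop{\smile\hspace{ -0.9em}|}^d$ for non-dividing independence ($\mathop{\smile\hspace{ -0.9em}|}$ is the usual independence symbol), means that $tp(a/BC)$ does not divide over $C$. A partial type $p(x)$ over $A$ is supersimple if for every $B\supseteq A$ and every realization $a$ of $p$ there is a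 finite set $B_0\subseteq B$ such that $tp(a/B)$ does not divide over $AB_0$. -}

module Defs where

open import Level using (Level; Lift; lower) renaming (suc to lsuc)
open import Data.Empty.Polymorphic using (⊥)
open import Data.Fin.Base using (Fin)
open import Data.List.Base as List using (List)
open import Data.List.Relation.Unary.All as ListAll using ()
import Data.List.Relation.Unary.All.Properties as ListAllₚ
open import Data.List.Relation.Unary.Any as ListAny using ()
open import Data.Nat.Base using (ℕ; suc; _+_)
open import Data.Product.Base using (Σ; ∃; _×_; _,_)
open import Data.Sum.Base using (_⊎_; [_,_]′)
open import Data.Vec.Base as Vec using (Vec; []; _∷_; _++_; lookup)
open import Data.Vec.Properties using (lookup-map; map-++; map-∘; map-cong; map-id)
open import Data.Vec.Relation.Unary.All as VecAll using ()
import Data.Vec.Relation.Unary.All.Properties as VecAllₚ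
open import Function.Base using (_∘_; id)
open import Function.Bundles using (_⇔_; _↔_; Equivalence; Inverse)
open import Function.Definitions using (Injective)
open import Relation.Binary.PropositionalEquality
  using (_≡_; refl; sym; trans; cong; cong₂; subst; module ≡-Reasoning)
open import Relation.Nullary.Construct.Add.Supremum using (_⁺; ⊤⁺)
import Relation.Binary.Construct.Add.Supremum.Equality as Equality⁺
import Relation.Binary.Construct.Add.Supremum.NonStrict as NonStrict⁺
import Relation.Binary.Construct.Add.Supremum.Strict as Strict⁺
open import Relation.Nullary.Negation.Core using (¬_)
open import Relation.Unary using (Pred; _∈_; _⊆_; _≐_)

-- Smallness is expressed by universes: languages and parameter sets live in
-- Set ℓ, the monster model in Set (lsuc ℓ).

------------------------------------------------------------------------
-- Ordinals

-- sup⁺ f is the least ordinal strictly above all f i.  Ordinals are compared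
-- by _≤_, and equality of ordinals is _≈_ rather than _≡_.

data Ord (o : Level) : Set (lsuc o) where
  sup⁺ : {I : Set o} → (I → Ord o) → Ord o

module _ {o : Level} where

  infix 4 _≤_ _<_ _≈_

  _≤_ : Ord o → Ord o → Set o
  sup⁺ f ≤ sup⁺ g = ∀ i → ∃ λ j → f i ≤ g j

  _<_ : Ord o → Ord o → Set o
  α < sup⁺ g = ∃ λ j → α ≤ g j

  _≈_ : Ord o → Ord o → Set o
  α ≈ β = α ≤ β × β ≤ α

  -- Ord o ⁺ is Ord ∪ {∞}, with ∞ = ⊤⁺.
  open Equality⁺ _≈_ public using (_≈⁺_)
  open NonStrict⁺ _≤_ public using (_≤⁺_)
  open Strict⁺ _<_ public using (_<⁺_)

------------------------------------------------------------------------
-- First-order logic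

record Language (ℓ : Level) : Set (lsuc ℓ) where
  field
    Func : ℕ → Set ℓ
    Rel  : ℕ → Set ℓ

open Language public

module _ {ℓ : Level} (L : Language ℓ) where

  data Term (n : ℕ) : Set ℓ where
    var : Fin n → Term n
    fun : ∀ {k} → Func L k → Vec (Term n) k → Term n

  -- Formula n: free variables in Fin n; under ∀ᶠ, index zero is the bound
  -- variable.  The remaining connectives are classically definable.
  data Formula : ℕ → Set ℓ where
    ⊥ᶠ   : ∀ {n} → Formula n
    _≐ᶠ_ : ∀ {n} → Term n → Term n → Formula n
    rel  : ∀ {n k} → Rel L k → Vec (Term n) k → Formula n
    _⇒ᶠ_ : ∀ {n} → Formula n → Formula n → Formula n
    ∀ᶠ_  : ∀ {n} → Formula (suc n) → Formula n

  record Structure : Set (lsuc (lsuc ℓ)) where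
    field
      Carrier   : Set (lsuc ℓ)
      inhabited : Carrier
      ⟦_⟧ᶠ      : ∀ {k} → Func L k → Vec Carrier k → Carrier
      ⟦_⟧ʳ      : ∀ {k} → Rel L k → Vec Carrier k → Set (lsuc ℓ)

module _ {ℓ : Level} {L : Language ℓ} where

  infix 30 ¬ᶠ_

  ¬ᶠ_ : ∀ {n} → Formula L n → Formula L n
  ¬ᶠ φ = φ ⇒ᶠ ⊥ᶠ

  module Semantics (M : Structure L) where
    open Structure M

    mutual
      eval : ∀ {n} → Vec Carrier n → Term L n → Carrier
      eval ρ (var x)    = lookup ρ x
      eval ρ (fun f ts) = ⟦ f ⟧ᶠ (evals ρ ts)

      evals : ∀ {n k} → Vec Carrier n → Vec (Term L n) k → Vec Carrier k
      evals ρ []       = []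
      evals ρ (t ∷ ts) = eval ρ t ∷ evals ρ ts

    Sat : ∀ {n} → Formula L n → Vec Carrier n → Set (lsuc ℓ)
    Sat ⊥ᶠ         ρ = ⊥
    Sat (s ≐ᶠ t)   ρ = eval ρ s ≡ eval ρ t
    Sat (rel r ts) ρ = ⟦ r ⟧ʳ (evals ρ ts)
    Sat (φ ⇒ᶠ ψ)   ρ = Sat φ ρ → Sat ψ ρ
    Sat (∀ᶠ φ)     ρ = ∀ a → Sat φ (a ∷ ρ)

module _ {ℓ : Level} (L : Language ℓ) where

  Theory : Set (lsuc ℓ)
  Theory = Pred (Formula L 0) ℓ

module _ {ℓ : Level} {L : Language ℓ} where

  IsModel : Structure L → Theory L → Set (lsuc ℓ)
  IsModel M T = ∀ {σ} → σ ∈ T → Semantics.Sat M σ []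

  Entails : Theory L → Formula L 0 → Set (lsuc (lsuc ℓ))
  Entails T σ = ∀ (M : Structure L) → IsModel M T → Semantics.Sat M σ []

  record CompleteTheory (T : Theory L) : Set (lsuc (lsuc ℓ)) where
    field
      consistent : ∃ λ M → IsModel M T
      decides    : ∀ σ → Entails T σ ⊎ Entails T (¬ᶠ σ)

------------------------------------------------------------------------
-- Types in a structure

module Types {ℓ : Level} {L : Language ℓ} (M : Structure L) where
  open Structure M public using (Carrier)
  open Structure M using (⟦_⟧ᶠ; ⟦_⟧ʳ)
  open Semantics M public

  record SmallSet : Set (lsuc ℓ) where
    field
      Index : Set ℓ
      elem  : Index → Carrier

  open SmallSet public

  infix 4 _∈ˢ_ _⊆ˢ_
  infixr 6 _∪ˢ_

  _∈ˢ_ : Carrier → SmallSet → Set (lsuc ℓ)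
  a ∈ˢ A = ∃ λ i → elem A i ≡ a

  _⊆ˢ_ : SmallSet → SmallSet → Set (lsuc ℓ)
  A ⊆ˢ B = ∀ {a} → a ∈ˢ A → a ∈ˢ B

  _∪ˢ_ : SmallSet → SmallSet → SmallSet
  A ∪ˢ B = record { Index = Index A ⊎ Index B ; elem = [ elem A , elem B ]′ }

  fromList : List Carrier → SmallSet
  fromList as = record
    { Index = Lift ℓ (Fin (List.length as))
    ; elem  = List.lookup as ∘ lower
    }

  -- A formula φ(x, b) with n-tuple x of free variables and parameters b in M.
  record PFormula (n : ℕ) : Set (lsuc ℓ) where
    constructor _[_]
    field
      {arity} : ℕ
      formula : Formula L (n + arity)
      params  : Vec Carrier arity

  open PFormula public

  infix 4 _⊨_

  _⊨_ : ∀ {n} → Vec Carrier n → PFormula n → Set (lsuc ℓ)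
  a ⊨ (φ [ b ]) = Sat φ (a ++ b)

  ¬ᵖ_ : ∀ {n} → PFormula n → PFormula n
  ¬ᵖ (φ [ b ]) = (¬ᶠ φ) [ b ]

  Over : ∀ {n} → SmallSet → PFormula n → Set (lsuc ℓ)
  Over A φ = VecAll.All (_∈ˢ A) (params φ)

  FormulaSet : ℕ → Set (lsuc (lsuc ℓ))
  FormulaSet n = Pred (PFormula n) (lsuc ℓ)

  Realizes : ∀ {n} → Vec Carrier n → FormulaSet n → Set (lsuc ℓ)
  Realizes a p = ∀ {φ} → φ ∈ p → a ⊨ φ

  FinitelySatisfiable : ∀ {n} → FormulaSet n → Set (lsuc ℓ)
  FinitelySatisfiable p =
    ∀ Δ → ListAll.All (_∈ p) Δ → ∃ λ a → ListAll.All (a ⊨_) Δ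

  record IsPartialType {n} (A : SmallSet) (p : FormulaSet n) : Set (lsuc ℓ) where
    field
      over       : ∀ {φ} → φ ∈ p → Over A φ
      consistent : FinitelySatisfiable p

  record IsCompleteType {n} (A : SmallSet) (p : FormulaSet n) : Set (lsuc ℓ) where
    field
      isPartialType : IsPartialType A p
      complete      : ∀ {φ} → Over A φ → φ ∈ p ⊎ (¬ᵖ φ) ∈ p
    open IsPartialType isPartialType public

  record CompleteType (n : ℕ) : Set (lsuc (lsuc ℓ)) where
    field
      dom            : SmallSet
      formulas       : FormulaSet n
      isCompleteType : IsCompleteType dom formulas
    open IsCompleteType isCompleteType public

  open CompleteType public using (dom; formulas)

  tp : ∀ {n} → Vec Carrier n → SmallSet → FormulaSet n
  tp a A φ = Over A φ × a ⊨ φ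

  infix 4 _≡[_]_

  _≡[_]_ : ∀ {n} → Vec Carrier n → SmallSet → Vec Carrier n → Set (lsuc ℓ)
  a ≡[ C ] b = tp a C ≐ tp b C

  ----------------------------------------------------------------------
  -- Dividing and forking

  -- The family (φ(x, bᵢ))ᵢ is k-inconsistent (as an indexed family, so
  -- repetitions among the bᵢ count).
  Inconsistent : ∀ {n j} → ℕ → Formula L (n + j) → (ℕ → Vec Carrier j) → Set (lsuc ℓ)
  Inconsistent k φ b = ∀ (s : Fin k → ℕ) → Injective _≡_ _≡_ s →
    ¬ (∃ λ a → ∀ i → a ⊨ (φ [ b (s i) ]))

  FormulaDivides : ∀ {n} → PFormula n → SmallSet → Set (lsuc ℓ)
  FormulaDivides (φ [ b ]) C = ∃ λ k → ∃ λ (bs : ℕ → Vec Carrier _) →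
    (∀ i → bs i ≡[ C ] b) × Inconsistent k φ bs

  -- Implication is semantic in M, which for the small p used below and a
  -- saturated M is the same as logical implication.
  Divides : ∀ {n} → FormulaSet n → SmallSet → Set (lsuc ℓ)
  Divides p C = ∃ λ φ → FormulaDivides φ C × (∀ a → Realizes a p → a ⊨ φ)

  -- The list Δ stands for the disjunction of its members.
  Forks : ∀ {n} → FormulaSet n → SmallSet → Set (lsuc ℓ)
  Forks p C = ∃ λ Δ → ListAll.All (λ φ → FormulaDivides φ C) Δ ×
    (∀ a → Realizes a p → ListAny.Any (a ⊨_) Δ)

  Supersimple : ∀ {n} → SmallSet → FormulaSet n → Set (lsuc ℓ)
  Supersimple A p = ∀ B → A ⊆ˢ B → ∀ a → Realizes a p →
    ∃ λ B₀ → ListAll.All (_∈ˢ B) B₀ × ¬ Divides (tp a B) (A ∪ˢ fromList B₀)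

  ----------------------------------------------------------------------
  -- Automorphisms

  record Automorphism : Set (lsuc ℓ) where
    field
      bijection : Carrier ↔ Carrier
    open Inverse bijection public using (to; from)
    field
      preserves-fun : ∀ {k} (f : Func L k) as → to (⟦ f ⟧ᶠ as) ≡ ⟦ f ⟧ᶠ (Vec.map to as)
      preserves-rel : ∀ {k} (r : Rel L k) as → ⟦ r ⟧ʳ as ⇔ ⟦ r ⟧ʳ (Vec.map to as)

  module _ (f : Automorphism) where
    open Automorphism f
    open Inverse bijection using (strictlyInverseˡ; strictlyInverseʳ)
    open ≡-Reasoning

    map-to-from : ∀ {k} (as : Vec Carrier k) → Vec.map to (Vec.map from as) ≡ as
    map-to-from as = begin
      Vec.map to (Vec.map from as) ≡⟨ map-∘ to from as ⟨
      Vec.map (to ∘ from) as       ≡⟨ map-cong strictlyInverseˡ as ⟩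
      Vec.map id as                ≡⟨ map-id as ⟩
      as                           ∎

    mutual
      eval-map : ∀ {n} (ρ : Vec Carrier n) t → to (eval ρ t) ≡ eval (Vec.map to ρ) t
      eval-map ρ (var x)    = sym (lookup-map x to ρ)
      eval-map ρ (fun g ts) =
        trans (preserves-fun g (evals ρ ts)) (cong ⟦ g ⟧ᶠ (evals-map ρ ts))

      evals-map : ∀ {n k} (ρ : Vec Carrier n) (ts : Vec (Term L n) k) →
                  Vec.map to (evals ρ ts) ≡ evals (Vec.map to ρ) ts
      evals-map ρ []       = refl
      evals-map ρ (t ∷ ts) = cong₂ _∷_ (eval-map ρ t) (evals-map ρ ts)

    to-injective : ∀ {a b} → to a ≡ to b → a ≡ b
    to-injective {a} {b} eq =
      trans (sym (strictlyInverseʳ a)) (trans (cong from eq) (strictlyInverseʳ b))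

    mutual
      Sat-map⁺ : ∀ {n} (φ : Formula L n) {ρ} → Sat φ ρ → Sat φ (Vec.map to ρ)
      Sat-map⁺ (s ≐ᶠ t) {ρ} eq =
        trans (sym (eval-map ρ s)) (trans (cong to eq) (eval-map ρ t))
      Sat-map⁺ (rel r ts) {ρ} h =
        subst ⟦ r ⟧ʳ (evals-map ρ ts) (Equivalence.to (preserves-rel r (evals ρ ts)) h)
      Sat-map⁺ (φ ⇒ᶠ ψ) h x = Sat-map⁺ ψ (h (Sat-map⁻ φ x))
      Sat-map⁺ (∀ᶠ φ) {ρ} h a =
        subst (λ c → Sat φ (c ∷ Vec.map to ρ)) (strictlyInverseˡ a) (Sat-map⁺ φ (h (from a)))

      Sat-map⁻ : ∀ {n} (φ : Formula L n) {ρ} → Sat φ (Vec.map to ρ) → Sat φ ρ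
      Sat-map⁻ (s ≐ᶠ t) {ρ} eq =
        to-injective (trans (eval-map ρ s) (trans eq (sym (eval-map ρ t))))
      Sat-map⁻ (rel r ts) {ρ} h =
        Equivalence.from (preserves-rel r (evals ρ ts)) (subst ⟦ r ⟧ʳ (sym (evals-map ρ ts)) h)
      Sat-map⁻ (φ ⇒ᶠ ψ) h x = Sat-map⁻ ψ (h (Sat-map⁺ φ x))
      Sat-map⁻ (∀ᶠ φ) h a = Sat-map⁻ φ (h (to a))

    image : SmallSet → SmallSet
    image A = record { Index = Index A ; elem = to ∘ elem A }

    pullback : ∀ {n} → PFormula n → PFormula n
    pullback (φ [ c ]) = φ [ Vec.map from c ]

    -- φ(x, c) belongs to pᶠ iff φ(x, f⁻¹(c)) belongs to p.
    conjugateFormulas : ∀ {n} → FormulaSet n → FormulaSet n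
    conjugateFormulas p φ = pullback φ ∈ p

    ⊨-pullback : ∀ {n} {a : Vec Carrier n} φ → a ⊨ pullback φ → Vec.map to a ⊨ φ
    ⊨-pullback {a = a} (φ [ c ]) h = subst (Sat φ)
      (trans (map-++ to a (Vec.map from c)) (cong (Vec.map to a ++_) (map-to-from c)))
      (Sat-map⁺ φ h)

    ∈-image : ∀ {A a} → a ∈ˢ A → to a ∈ˢ image A
    ∈-image (i , eq) = i , cong to eq

    ∈-image⁻ : ∀ {A a} → a ∈ˢ image A → from a ∈ˢ A
    ∈-image⁻ (i , eq) = i , trans (sym (strictlyInverseʳ _)) (cong from eq)

    conjugate : ∀ {n} → CompleteType n → CompleteType n
    conjugate p = record
      { dom            = image (dom p)
      ; formulas       = conjugateFormulas (formulas p)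
      ; isCompleteType = record
        { isPartialType = record
          { over       = λ {φ} φ∈pᶠ → subst (VecAll.All (_∈ˢ image (dom p)))
              (map-to-from (params φ))
              (VecAllₚ.map⁺ (VecAll.map ∈-image (CompleteType.over p φ∈pᶠ)))
          ; consistent = λ Δ Δ⊆pᶠ →
              let a , a⊨ = CompleteType.consistent p (List.map pullback Δ) (ListAllₚ.map⁺ Δ⊆pᶠ)
              in  Vec.map to a , ListAll.map (λ {φ} → ⊨-pullback φ) (ListAllₚ.map⁻ a⊨)
          }
        ; complete = λ φ-over →
            CompleteType.complete p (VecAllₚ.map⁺ (VecAll.map ∈-image⁻ φ-over))
        }
      }

  ----------------------------------------------------------------------
  -- Saturation and homogeneity

  Saturated : Set (lsuc (lsuc ℓ))
  Saturated = ∀ {n} (A : SmallSet) (p : FormulaSet n) → IsPartialType A p →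
    ∃ λ a → Realizes a p

  StronglyHomogeneous : Set (lsuc ℓ)
  StronglyHomogeneous = ∀ {I : Set ℓ} (a b : I → Carrier) →
    (∀ {k} (φ : Formula L k) (is : Vec I k) → Sat φ (Vec.map a is) ⇔ Sat φ (Vec.map b is)) →
    Σ Automorphism λ f → ∀ i → Automorphism.to f (a i) ≡ b i

  ----------------------------------------------------------------------
  -- Classes of complete types and ranks

  infix 4 _⊑_

  _⊑_ : ∀ {n} → CompleteType n → CompleteType n → Set (lsuc ℓ)
  p ⊑ q = formulas p ⊆ formulas q

  TypeFamily : Set (lsuc (lsuc (lsuc ℓ)))
  TypeFamily = ∀ {n} → Pred (CompleteType n) (lsuc (lsuc ℓ))

  record IsClass (𝔄 : TypeFamily) : Set (lsuc (lsuc ℓ)) where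
    field
      extension   : ∀ {n} {p q : CompleteType n} → p ∈ 𝔄 → p ⊑ q → q ∈ 𝔄
      conjugation : ∀ {n} {p : CompleteType n} f → p ∈ 𝔄 → conjugate f p ∈ 𝔄

  -- The least class containing every completion of p over A.
  data ⟨_∣_⟩ {n} (A : SmallSet) (p : FormulaSet n) : TypeFamily where
    completion  : ∀ {q} → p ⊆ q → (c : IsCompleteType A q) →
                  record { dom = A ; formulas = q ; isCompleteType = c } ∈ ⟨ A ∣ p ⟩
    extension   : ∀ {m} {q r : CompleteType m} → q ∈ ⟨ A ∣ p ⟩ → q ⊑ r → r ∈ ⟨ A ∣ p ⟩
    conjugation : ∀ {m} {q : CompleteType m} f → q ∈ ⟨ A ∣ p ⟩ → conjugate f q ∈ ⟨ A ∣ p ⟩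

  -- Ordinals indexed by the universe of complete types, so that every
  -- well-founded relation between complete types has its rank among them.
  Ordinal : Set (lsuc (lsuc (lsuc ℓ)))
  Ordinal = Ord (lsuc (lsuc ℓ))

  record Rank (𝔄 : TypeFamily) : Set (lsuc (lsuc (lsuc ℓ))) where
    field
      rank        : ∀ {n} (p : CompleteType n) → p ∈ 𝔄 → Ordinal ⁺
      heredity    : ∀ {n} {p q : CompleteType n} (p∈𝔄 : p ∈ 𝔄) (q∈𝔄 : q ∈ 𝔄) →
                    p ⊑ q → rank q q∈𝔄 ≤⁺ rank p p∈𝔄
      isomorphism : ∀ {n} {p : CompleteType n} f (p∈𝔄 : p ∈ 𝔄) (pᶠ∈𝔄 : conjugate f p ∈ 𝔄) →
                    rank p p∈𝔄 ≈⁺ rank (conjugate f p) pᶠ∈𝔄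

  module _ {𝔄 : TypeFamily} (R : Rank 𝔄) where
    open Rank R

    Ranks : ∀ {n} (p : CompleteType n) → p ∈ 𝔄 → Set (lsuc (lsuc (lsuc ℓ)))
    Ranks p p∈𝔄 = rank p p∈𝔄 <⁺ ⊤⁺

    IsRankFor : (∀ {n} → FormulaSet n → SmallSet → Set (lsuc ℓ)) → Set (lsuc (lsuc (lsuc ℓ)))
    IsRankFor _↯_ = ∀ {n} {p q : CompleteType n} (p∈𝔄 : p ∈ 𝔄) (q∈𝔄 : q ∈ 𝔄) →
      p ⊑ q → Ranks p p∈𝔄 → formulas q ↯ dom p → rank q q∈𝔄 <⁺ rank p p∈𝔄

    IsDividingRank : Set (lsuc (lsuc (lsuc ℓ)))
    IsDividingRank = IsRankFor Divides

    IsForkingRank : Set (lsuc (lsuc (lsuc ℓ)))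
    IsForkingRank = IsRankFor Forks

    RanksAll : TypeFamily → Set (lsuc (lsuc (lsuc ℓ)))
    RanksAll 𝔅 = ∀ {n} {q : CompleteType n} → q ∈ 𝔅 → Σ (q ∈ 𝔄) (Ranks q)

------------------------------------------------------------------------
-- Monster models

record MonsterModel {ℓ : Level} {L : Language ℓ} (T : Theory L) : Set (lsuc (lsuc ℓ)) where
  field
    structure           : Structure L
    isModel             : IsModel structure T
    saturated           : Types.Saturated structure
    stronglyHomogeneous : Types.StronglyHomogeneous structure

{-# OPTIONS --safe #-}
module Submission where

-- For a small set C and a satisfiable partial type π over C write
-- (C′, π′) ◁ (C, π) if C ⊆ C′, π′ implies π and π′ divides over C.  If p is
-- supersimple then ◁ is well-founded below (A, p): realizing the union of a
-- descending chain would give a type dividing over all finite subsets of its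
-- domain.  The foundation rank of (dom q, q) is then a dividing rank, and it is
-- a forking rank because ranking partial types, rather than complete ones only,
-- gives it the extension property: if π implies φ₁ ∨ … ∨ φₖ then the rank of π
-- is at most that of some π ∪ {φᵢ}.  This needs no theory of forking, only that
-- a formula θ(x, c) dividing over C has a C-conjugate dividing over C ∪ E, for
-- any small E.  Conversely, if tp(a/B) divides over A ∪ B₀ for every finite
-- B₀ ⊆ B, compactness yields finite B₁ ⊇ B₀ such that tp(a/A ∪ B₁) divides over
-- A ∪ B₀, so that any dividing rank descends forever.

open import Defs
open import Axiom.ExcludedMiddle using (ExcludedMiddle)
open import Data.Empty using (⊥; ⊥-elim)
open import Data.Fin.Base as Fin using (Fin; zero; suc; _↑ˡ_; _↑ʳ_; join; splitAt; combine)
open import Data.List.Base as List using (List; []; _∷_)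
open import Data.List.Membership.Propositional.Properties using (∈-lookup; ∈-concat⁺′; ∈-map⁺)
open import Data.List.Relation.Unary.All as ListAll using ([]; _∷_)
import Data.List.Relation.Unary.All.Properties as ListAllₚ
open import Data.List.Relation.Unary.Any as ListAny using (here)
open import Data.List.Relation.Unary.Any.Properties using (lookup-index)
open import Data.Nat.Base as ℕ using (ℕ; zero; suc; _+_; _*_)
import Data.Nat.Properties as ℕₚ
open import Data.Product.Base using (Σ; ∃; _×_; _,_; proj₁; proj₂)
open import Data.Sum.Base as Sum using (_⊎_; inj₁; inj₂; [_,_]′)
open import Data.Vec.Base as Vec using (Vec; []; _∷_; _++_; lookup; concat)
open import Data.Vec.Properties
  using (lookup-++ˡ; lookup-++ʳ; lookup-splitAt; lookup-map; lookup-cast; lookup-concat;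
         ++-assoc-eqFree; map-++)
open import Data.Vec.Relation.Unary.All as VecAll using ([]; _∷_)
import Data.Vec.Relation.Unary.All.Properties as VecAllₚ
open import Function.Base using (_∘_; id)
open import Function.Bundles using (_⇔_; Equivalence; Inverse; mk⇔)
open import Function.Definitions using (Injective)
open import Function.Properties.Inverse using (↔-sym)
open import Induction.WellFounded using (Acc; acc)
open import Level using (Level; lift; lower; Lift) renaming (suc to lsuc)
open import Relation.Binary.Definitions using (tri<; tri≈; tri>)
open import Relation.Binary.PropositionalEquality
  using (_≡_; refl; sym; trans; cong; cong₂; subst; subst₂)
import Relation.Binary.Construct.Add.Supremum.Equality as Equality⁺
import Relation.Binary.Construct.Add.Supremum.NonStrict as NonStrict⁺
import Relation.Binary.Construct.Add.Supremum.Strict as Strict⁺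
open import Relation.Nullary.Construct.Add.Supremum as Sup using (_⁺; ⊤⁺)
open import Relation.Nullary.Decidable.Core using (yes; no; decidable-stable)
open import Relation.Nullary.Negation.Core using (¬_)
open import Relation.Unary using (_∈_)

open Equivalence using (to; from)

-- Renaming of variables in first-order formulas

module _ {ℓ : Level} {L : Language ℓ} where

  mutual
    renameᵗ : ∀ {m n} → (Fin m → Fin n) → Term L m → Term L n
    renameᵗ ρ (var x)    = var (ρ x)
    renameᵗ ρ (fun f ts) = fun f (renameᵗˢ ρ ts)

    renameᵗˢ : ∀ {m n k} → (Fin m → Fin n) → Vec (Term L m) k → Vec (Term L n) k
    renameᵗˢ ρ []       = []
    renameᵗˢ ρ (t ∷ ts) = renameᵗ ρ t ∷ renameᵗˢ ρ ts

  rename : ∀ {m n} → (Fin m → Fin n) → Formula L m → Formula L n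
  rename ρ ⊥ᶠ         = ⊥ᶠ
  rename ρ (s ≐ᶠ t)   = renameᵗ ρ s ≐ᶠ renameᵗ ρ t
  rename ρ (rel r ts) = rel r (renameᵗˢ ρ ts)
  rename ρ (φ ⇒ᶠ ψ)   = rename ρ φ ⇒ᶠ rename ρ ψ
  rename ρ (∀ᶠ φ)     = ∀ᶠ rename (Fin.lift 1 ρ) φ

  module _ (M : Structure L) where
    open Structure M
    open Semantics M

    mutual
      eval-rename : ∀ {m n} (ρ : Fin m → Fin n) {u v} → (∀ i → lookup u i ≡ lookup v (ρ i)) →
                    ∀ t → eval v (renameᵗ ρ t) ≡ eval u t
      eval-rename ρ e (var x)    = sym (e x)
      eval-rename ρ e (fun f ts) = cong ⟦ f ⟧ᶠ (evals-rename ρ e ts)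

      evals-rename : ∀ {m n k} (ρ : Fin m → Fin n) {u v} → (∀ i → lookup u i ≡ lookup v (ρ i)) →
                     ∀ (ts : Vec _ k) → evals v (renameᵗˢ ρ ts) ≡ evals u ts
      evals-rename ρ e []       = refl
      evals-rename ρ e (t ∷ ts) = cong₂ _∷_ (eval-rename ρ e t) (evals-rename ρ e ts)

    -- The two assignments need only agree along `ρ`. This form passes under a quantifier: both are
    -- extended by the same element and `ρ` is lifted.
    Sat-rename : ∀ {m n} (ρ : Fin m → Fin n) {u v} → (∀ i → lookup u i ≡ lookup v (ρ i)) →
                 ∀ φ → Sat (rename ρ φ) v ⇔ Sat φ u
    Sat-rename ρ e ⊥ᶠ         = mk⇔ id id
    Sat-rename ρ e (s ≐ᶠ t)   = mk⇔
      (subst₂ _≡_ (eval-rename ρ e s) (eval-rename ρ e t))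
      (subst₂ _≡_ (sym (eval-rename ρ e s)) (sym (eval-rename ρ e t)))
    Sat-rename ρ e (rel r ts) = mk⇔
      (subst ⟦ r ⟧ʳ (evals-rename ρ e ts)) (subst ⟦ r ⟧ʳ (sym (evals-rename ρ e ts)))
    Sat-rename ρ e (φ ⇒ᶠ ψ)   = mk⇔
      (λ h x → to (Sat-rename ρ e ψ) (h (from (Sat-rename ρ e φ) x)))
      (λ h x → from (Sat-rename ρ e ψ) (h (to (Sat-rename ρ e φ) x)))
    Sat-rename ρ {u} {v} e (∀ᶠ φ) = mk⇔
      (λ h a → to (Sat-rename (Fin.lift 1 ρ) (lifted a) φ) (h a))
      (λ h a → from (Sat-rename (Fin.lift 1 ρ) (lifted a) φ) (h a))
      where
      lifted : ∀ a i → lookup (a ∷ u) i ≡ lookup (a ∷ v) (Fin.lift 1 ρ i)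
      lifted a zero    = refl
      lifted a (suc i) = e i

-- Maps of finite index sets, and initial segments of sequences

infixr 4 _⊕_

_⊕_ : ∀ {m n m′ n′} → (Fin m → Fin m′) → (Fin n → Fin n′) → Fin (m + n) → Fin (m′ + n′)
_⊕_ {m} ρ σ i = join _ _ (Sum.map ρ σ (splitAt m i))

lookup-⊕ : ∀ {a} {X : Set a} {m n m′ n′} {ρ : Fin m → Fin m′} {σ : Fin n → Fin n′}
           {u : Vec X m} {v : Vec X n} {u′ : Vec X m′} {v′ : Vec X n′} →
           (∀ i → lookup u i ≡ lookup u′ (ρ i)) → (∀ i → lookup v i ≡ lookup v′ (σ i)) →
           ∀ i → lookup (u ++ v) i ≡ lookup (u′ ++ v′) ((ρ ⊕ σ) i)
lookup-⊕ {m = m} {ρ = ρ} {σ} {u} {v} {u′} {v′} e e′ i =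
  trans (lookup-splitAt m u v i) (lemma (splitAt m i))
  where
  lemma : ∀ s → [ lookup u , lookup v ]′ s ≡ lookup (u′ ++ v′) (join _ _ (Sum.map ρ σ s))
  lemma (inj₁ j) = trans (e j) (sym (lookup-++ˡ u′ v′ (ρ j)))
  lemma (inj₂ j) = trans (e′ j) (sym (lookup-++ʳ u′ v′ (σ j)))

-- Latest entry first, so that prolonging a segment is consing, as in the stepwise construction of a
-- generic sequence.
prefix : ∀ {a} {X : Set a} → (ℕ → X) → ∀ m → Vec X m
prefix g zero    = []
prefix g (suc m) = g m ∷ prefix g m

-- The index is found before `g` is given, so a single formula can speak of the `i`-th entry of
-- every sequence.
position : ∀ {a} {X : Set a} {i m} → i ℕ.< m →
           ∃ λ (s : Fin m) → ∀ (g : ℕ → X) → lookup (prefix g m) s ≡ g i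
position {m = suc m} i<1+m with ℕₚ.m<1+n⇒m<n∨m≡n i<1+m
... | inj₁ i<m  = let s , e = position i<m in suc s , e
... | inj₂ refl = zero , λ g → refl

bounded : ∀ {k} (s : Fin k → ℕ) → ∃ λ m → ∀ t → s t ℕ.< m
bounded {zero}  s = 0 , λ ()
bounded {suc k} s = let m , s< = bounded (s ∘ suc) in suc (s zero) ℕ.⊔ m , λ
  { zero    → ℕₚ.m≤m⊔n (suc (s zero)) m
  ; (suc t) → ℕₚ.<-≤-trans (s< t) (ℕₚ.m≤n⊔m (suc (s zero)) m) }

increasing : ∀ {s : ℕ → ℕ} → (∀ i → s i ℕ.< s (suc i)) → ∀ {i k} → i ℕ.< k → s i ℕ.< s k
increasing {s} step {i} {suc k} i<1+k with ℕₚ.m<1+n⇒m<n∨m≡n i<1+k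
... | inj₁ i<k  = ℕₚ.<-trans (increasing step i<k) (step k)
... | inj₂ refl = step k

strictlyIncreasing⇒injective : ∀ {s : ℕ → ℕ} → (∀ i → s i ℕ.< s (suc i)) → Injective _≡_ _≡_ s
strictlyIncreasing⇒injective {s} step {i} {k} e with ℕₚ.<-cmp i k
... | tri< i<k _ _ = ⊥-elim (ℕₚ.<-irrefl e (increasing step i<k))
... | tri≈ _ i≡k _ = i≡k
... | tri> _ _ k<i = ⊥-elim (ℕₚ.<-irrefl (sym e) (increasing step k<i))

eventually : ∀ {a p} {A : Set a} {P : ℕ → A → Set p} →
             (∀ {x i k} → i ℕ.≤ k → P i x → P k x) →
             ∀ {xs} → ListAll.All (λ x → ∃ λ i → P i x) xs → ∃ λ m → ListAll.All (P m) xs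
eventually mono []             = 0 , []
eventually mono ((i , Px) ∷ h) =
  let m , Pxs = eventually mono h
  in  i ℕ.⊔ m , mono (ℕₚ.m≤m⊔n i m) Px ∷ ListAll.map (mono (ℕₚ.m≤n⊔m i m)) Pxs

-- Order of the ordinals, with infinity

module _ {o : Level} where

  ≤-refl : (α : Ord o) → α ≤ α
  ≤-refl (sup⁺ f) i = i , ≤-refl (f i)

  ≤-trans : {α β γ : Ord o} → α ≤ β → β ≤ γ → α ≤ γ
  ≤-trans {sup⁺ _} {sup⁺ _} {sup⁺ _} α≤β β≤γ i =
    let j , αᵢ≤βⱼ = α≤β i
        k , βⱼ≤γₖ = β≤γ j
    in  k , ≤-trans αᵢ≤βⱼ βⱼ≤γₖ

  ≤-<-trans : {α β γ : Ord o} → α ≤ β → β < γ → α < γ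
  ≤-<-trans {γ = sup⁺ _} α≤β (k , β≤γₖ) = k , ≤-trans α≤β β≤γₖ

  <-≤-trans : {α β γ : Ord o} → α < β → β ≤ γ → α < γ
  <-≤-trans {β = sup⁺ _} {sup⁺ _} (j , α≤βⱼ) β≤γ =
    let k , βⱼ≤γₖ = β≤γ j in k , ≤-trans α≤βⱼ βⱼ≤γₖ

  sup⁺-≤ : {I : Set o} {f : I → Ord o} {β : Ord o} → (∀ i → f i < β) → sup⁺ f ≤ β
  sup⁺-≤ {β = sup⁺ _} f<β = f<β

  <⊤⁺⇒≤⁺ : {x : Ord o ⁺} → x <⁺ ⊤⁺ → ∃ λ α → x ≤⁺ Sup.[ α ]
  <⊤⁺⇒≤⁺ Strict⁺.[ α ]<⊤⁺ = α , NonStrict⁺.[ ≤-refl α ]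

  -- A strict descent below a bounded rank moves the bound itself to one of its branches, which
  -- permits structural recursion on the bound.
  <⁺-≤⁺-sup⁺ : {x y : Ord o ⁺} {I : Set o} {f : I → Ord o} →
               x <⁺ y → y ≤⁺ Sup.[ sup⁺ f ] → ∃ λ i → x ≤⁺ Sup.[ f i ]
  <⁺-≤⁺-sup⁺ Strict⁺.[ α<β ] NonStrict⁺.[ β≤γ ] =
    let i , α≤fᵢ = <-≤-trans α<β β≤γ in i , NonStrict⁺.[ α≤fᵢ ]

-- Classical facts: linearity of the ordinals, homogeneous subsequences

module _ (em : ∀ {a} → ExcludedMiddle a) where

  dne : ∀ {a} {P : Set a} → ¬ ¬ P → P
  dne = decidable-stable em

  -- Either some `f i` bounds every `g j`, or every `f i` fails to bound some `g j` and lies below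
  -- it by induction.
  ≤-total : ∀ {o} (α β : Ord o) → α ≤ β ⊎ β ≤ α
  ≤-total (sup⁺ f) (sup⁺ g) with em {P = ∃ λ i → ∀ j → g j ≤ f i}
  ... | yes (i , g≤fᵢ) = inj₂ λ j → i , g≤fᵢ j
  ... | no ¬∃ = inj₁ λ i → dne λ ¬fᵢ≤ → ¬∃ (i , λ j →
    [ (λ fᵢ≤gⱼ → ⊥-elim (¬fᵢ≤ (j , fᵢ≤gⱼ))) , id ]′ (≤-total (f i) (g j)))

  -- By linearity the largest of finitely many bounds serves for all; `j₀` is there for the empty
  -- list.
  commonBound : ∀ {o a q} {A : Set a} {Q : A → Ord o → Set q} →
                (∀ {x β γ} → β ≤ γ → Q x β → Q x γ) →
                ∀ {J : Set o} {g : J → Ord o} → J → ∀ {xs} →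
                ListAll.All (λ x → ∃ λ j → Q x (g j)) xs →
                ∃ λ j → ListAll.All (λ x → Q x (g j)) xs
  commonBound mono j₀ [] = j₀ , []
  commonBound mono {g = g} j₀ ((j , q) ∷ qs) with commonBound mono j₀ qs
  ... | k , qs′ with ≤-total (g j) (g k)
  ...   | inj₁ gⱼ≤gₖ = k , mono gⱼ≤gₖ q ∷ qs′
  ...   | inj₂ gₖ≤gⱼ = j , q ∷ ListAll.map (mono gₖ≤gⱼ) qs′

  -- If `P` fails from some `N` on, shifting by `N` avoids `P`; otherwise `P` holds at arbitrarily
  -- large indices, which are chosen increasingly.
  homogeneousSubsequence : ∀ {p} (P : ℕ → Set p) →
    ∃ λ s → Injective _≡_ _≡_ s × (∀ i k → P (s i) → P (s k))
  homogeneousSubsequence P with em {P = ∃ λ N → ∀ n → N ℕ.≤ n → ¬ P n}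
  ... | yes (N , ¬P) = (N +_) , ℕₚ.+-cancelˡ-≡ N _ _ , λ i _ Pi → ⊥-elim (¬P _ (ℕₚ.m≤m+n N i) Pi)
  ... | no ¬∃ =
    s , strictlyIncreasing⇒injective (λ i → proj₁ (proj₂ (next (suc (s i))))) , λ _ k _ → P∘s k
    where
    next : ∀ N → ∃ λ n → N ℕ.≤ n × P n
    next N = dne (λ ¬∃n → ¬∃ (N , λ n N≤n Pn → ¬∃n (n , N≤n , Pn)))

    s : ℕ → ℕ
    s zero    = proj₁ (next zero)
    s (suc i) = proj₁ (next (suc (s i)))

    P∘s : ∀ i → P (s i)
    P∘s zero    = proj₂ (proj₂ (next zero))
    P∘s (suc i) = proj₂ (proj₂ (next (suc (s i))))

  -- Connectives, quantifiers and substitution for formulas with parameters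

  module Classical {ℓ : Level} {L : Language ℓ} (M : Structure L) where
    open Types M

    reindex : ∀ {m n} → (Fin m → Fin n) → PFormula m → PFormula n
    reindex ρ φ = rename (ρ ⊕ id) (formula φ) [ params φ ]

    ⊨-reindex : ∀ {m n} {ρ : Fin m → Fin n} {a b} → (∀ i → lookup a i ≡ lookup b (ρ i)) →
                ∀ φ → b ⊨ reindex ρ φ ⇔ a ⊨ φ
    ⊨-reindex {ρ = ρ} {a} {b} e φ = Sat-rename M (ρ ⊕ id)
      (lookup-⊕ {u = a} {params φ} {b} {params φ} e (λ _ → refl)) (formula φ)

    widenˡ : ∀ {n} (φ ψ : PFormula n) → Fin (n + arity φ) → Fin (n + (arity φ + arity ψ))
    widenˡ {n} φ ψ = _⊕_ {n} id (_↑ˡ arity ψ)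

    widenʳ : ∀ {n} (φ ψ : PFormula n) → Fin (n + arity ψ) → Fin (n + (arity φ + arity ψ))
    widenʳ {n} φ ψ = _⊕_ {n} id (arity φ ↑ʳ_)

    infixr 5 _∧ᵖ_

    _∧ᵖ_ : ∀ {n} → PFormula n → PFormula n → PFormula n
    _∧ᵖ_ {n} φ ψ = ¬ᶠ (rename (widenˡ {n} φ ψ) (formula φ) ⇒ᶠ
                       ¬ᶠ rename (widenʳ {n} φ ψ) (formula ψ)) [ params φ ++ params ψ ]

    ⊨-∧ : ∀ {n} {a : Vec Carrier n} φ ψ → a ⊨ (φ ∧ᵖ ψ) ⇔ (a ⊨ φ × a ⊨ ψ)
    ⊨-∧ {n} {a} φ ψ = mk⇔
      (λ h → dne (λ ¬φ → lower (h (λ x → ⊥-elim (¬φ (to φ⇔ x)))))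
           , dne (λ ¬ψ → lower (h (λ _ y → ⊥-elim (¬ψ (to ψ⇔ y))))))
      (λ (x , y) h → h (from φ⇔ x) (from ψ⇔ y))
      where
      φ⇔ : Sat (rename (widenˡ φ ψ) (formula φ)) (a ++ (params φ ++ params ψ)) ⇔ a ⊨ φ
      φ⇔ = Sat-rename M (widenˡ φ ψ) (lookup-⊕ {u = a} {params φ} {a} {params φ ++ params ψ}
        (λ _ → refl) (λ i → sym (lookup-++ˡ (params φ) (params ψ) i))) (formula φ)

      ψ⇔ : Sat (rename (widenʳ φ ψ) (formula ψ)) (a ++ (params φ ++ params ψ)) ⇔ a ⊨ ψ
      ψ⇔ = Sat-rename M (widenʳ φ ψ) (lookup-⊕ {u = a} {params ψ} {a} {params φ ++ params ψ}
        (λ _ → refl) (λ i → sym (lookup-++ʳ (params φ) (params ψ) i))) (formula ψ)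

    ⊤ᵖ : ∀ {n} → PFormula n
    ⊤ᵖ = ¬ᶠ ⊥ᶠ [ [] ]

    ⋀ᵖ : ∀ {n} k → (Fin k → PFormula n) → PFormula n
    ⋀ᵖ zero    φ = ⊤ᵖ
    ⋀ᵖ (suc k) φ = φ zero ∧ᵖ ⋀ᵖ k (φ ∘ suc)

    ⊨-⋀ : ∀ {n} {a : Vec Carrier n} k φ → a ⊨ ⋀ᵖ k φ ⇔ (∀ i → a ⊨ φ i)
    ⊨-⋀ zero    φ = mk⇔ (λ _ ()) (λ _ → id)
    ⊨-⋀ (suc k) φ = mk⇔
      (λ h → let x , y = to (⊨-∧ (φ zero) (⋀ᵖ k (φ ∘ suc))) h in
             λ { zero → x ; (suc i) → to (⊨-⋀ k (φ ∘ suc)) y i })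
      (λ h → from (⊨-∧ (φ zero) (⋀ᵖ k (φ ∘ suc))) (h zero , from (⊨-⋀ k (φ ∘ suc)) (h ∘ suc)))

    Over-⋀ : ∀ {n C} k {φ : Fin k → PFormula n} → (∀ i → Over C (φ i)) → Over C (⋀ᵖ k φ)
    Over-⋀ zero    h = []
    Over-⋀ (suc k) h = VecAllₚ.++⁺ (h zero) (Over-⋀ k (h ∘ suc))

    ∃ᵖ : ∀ n {m} → PFormula (n + m) → PFormula m
    ∃ᵖ zero    φ = φ
    ∃ᵖ (suc n) φ = ∃ᵖ n (¬ᶠ (∀ᶠ ¬ᶠ (formula φ)) [ params φ ])

    ⊨-∃ : ∀ n {m} {a : Vec Carrier m} φ → a ⊨ ∃ᵖ n φ ⇔ (∃ λ (b : Vec Carrier n) → (b ++ a) ⊨ φ)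
    ⊨-∃ zero    φ = mk⇔ (λ h → [] , h) (λ { ([] , h) → h })
    ⊨-∃ (suc n) {a = a} φ = mk⇔
      (λ h → let b , ¬∀¬ = to (⊨-∃ n _) h
                 c , x = dne {P = ∃ λ c → (c ∷ b ++ a) ⊨ φ}
                   (λ ¬∃ → lower (¬∀¬ (λ c x → ⊥-elim (¬∃ (c , x)))))
             in  c ∷ b , x)
      (λ { (c ∷ b , x) → from (⊨-∃ n _) (b , λ ∀¬ → ∀¬ c x) })

    Over-∃ : ∀ {C} n {m} {φ : PFormula (n + m)} → Over C φ → Over C (∃ᵖ n φ)
    Over-∃ zero    h = h
    Over-∃ (suc n) h = Over-∃ n h

    -- The last `m` variables become parameters, so only the bracketing of the number of variables
    -- changes.
    instantiate : ∀ {n m} → PFormula (n + m) → Vec Carrier m → PFormula n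
    instantiate {n} {m} φ v =
      rename (Fin.cast (ℕₚ.+-assoc n m (arity φ))) (formula φ) [ v ++ params φ ]

    ⊨-instantiate : ∀ {n m} {a : Vec Carrier n} (φ : PFormula (n + m)) v →
                    a ⊨ instantiate φ v ⇔ (a ++ v) ⊨ φ
    ⊨-instantiate {n} {m} {a} φ v = Sat-rename M _ lemma (formula φ)
      where
      lemma : ∀ i → lookup ((a ++ v) ++ params φ) i ≡
                    lookup (a ++ (v ++ params φ)) (Fin.cast (ℕₚ.+-assoc n m (arity φ)) i)
      lemma i = trans (sym (lookup-cast (ℕₚ.+-assoc n m (arity φ)) _ i))
        (cong (λ w → lookup w (Fin.cast (ℕₚ.+-assoc n m (arity φ)) i))
              (++-assoc-eqFree a v (params φ)))

    -- Small parameter sets and equality of types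

    ∪-inˡ : ∀ {A B} → A ⊆ˢ (A ∪ˢ B)
    ∪-inˡ (i , e) = inj₁ i , e

    ∪-inʳ : ∀ {A B} → B ⊆ˢ (A ∪ˢ B)
    ∪-inʳ (i , e) = inj₂ i , e

    fromList-∈ : ∀ as → ListAll.All (_∈ˢ fromList as) as
    fromList-∈ as = ListAll.tabulate (λ p → lift (ListAny.index p) , sym (lookup-index p))

    fromVec : ∀ {k} → Vec Carrier k → SmallSet
    fromVec v = fromList (Vec.toList v)

    fromVec-∈ : ∀ {k} (v : Vec Carrier k) → VecAll.All (_∈ˢ fromVec v) v
    fromVec-∈ v = VecAllₚ.toList⁻ (fromList-∈ _)

    -- One direction suffices because the formulas over `C` are closed under negation.
    ≡[]-intro : ∀ {n C} {a b : Vec Carrier n} →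
                (∀ χ → Over C χ → b ⊨ χ → a ⊨ χ) → a ≡[ C ] b
    ≡[]-intro h =
      (λ {χ} (over , a⊨χ) → over , dne (λ ¬b⊨χ → lower (h (¬ᵖ χ) over (⊥-elim ∘ ¬b⊨χ) a⊨χ))) ,
      (λ {χ} (over , b⊨χ) → over , h χ over b⊨χ)

    -- Saturation for sequences of tuples

    module _ (saturated : Saturated) where

      -- Saturation in infinitely many variables.  W i v says that v is an initial
      -- segment of some sequence with the property indexed by i; every formula
      -- over C that some W i forces on initial segments holds in one sequence.
      module _ {j} {C : SmallSet} {I : Set (lsuc ℓ)}
        (W : I → ∀ {m} → Vec (Vec Carrier j) m → Set (lsuc ℓ))
        (directed : ∀ i i′ → ∃ λ k → ∀ {m} {v : Vec (Vec Carrier j) m} → W k v → W i v × W i′ v)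
        (i₀ : I)
        (start : ∀ i → W i [])
        (extend : ∀ i {m} {v : Vec (Vec Carrier j) m} → W i v → ∃ λ y → W i (y ∷ v))
        where

        Generic : ∀ m → FormulaSet (m * j)
        Generic m χ = Over C χ × ∃ λ i → ∀ {v : Vec _ m} → W i v → concat v ⊨ χ

        -- Finitely many generic formulas follow from a single one, by `directed`. Its existential
        -- quantification over the new entry is generic for length `m`, because segments can be
        -- extended, and so holds of `v`; saturation then supplies the entry.
        extendGeneric : ∀ {m} (v : Vec (Vec Carrier j) m) → Realizes (concat v) (Generic m) →
                        ∃ λ y → Realizes (concat (y ∷ v)) (Generic (suc m))
        extendGeneric {m} v v⊨ =
          let y , y⊨ = saturated (C ∪ˢ fromVec (concat v)) Instances record
                { over       = λ { (χ , (over , _) , refl) → VecAllₚ.++⁺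
                                   (VecAll.map ∪-inʳ (fromVec-∈ (concat v)))
                                   (VecAll.map ∪-inˡ over) }
                ; consistent = satisfiable
                }
          in  y , λ {χ} χ∈ →
              to (⊨-instantiate χ (concat v)) (y⊨ {instantiate χ (concat v)} (χ , χ∈ , refl))
          where
          Instances : FormulaSet j
          Instances φ = ∃ λ χ → Generic (suc m) χ × φ ≡ instantiate χ (concat v)

          conjunction : ∀ {Δ} → ListAll.All (_∈ Instances) Δ →
            ∃ λ χ → Generic (suc m) χ × (∀ y → (y ++ concat v) ⊨ χ → ListAll.All (y ⊨_) Δ)
          conjunction [] = ⊤ᵖ , ([] , i₀ , λ _ → id) , λ _ _ → []
          conjunction ((χ , (over , i , g) , refl) ∷ Δ⊆) =
            let χ′ , (over′ , i′ , g′) , h = conjunction Δ⊆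
                k , split = directed i i′
            in  χ ∧ᵖ χ′
              , (VecAllₚ.++⁺ over over′ , k , λ { {y ∷ w} Wk →
                  let Wi , Wi′ = split Wk in from (⊨-∧ χ χ′) (g Wi , g′ Wi′) })
              , λ y y⊨ → let x , x′ = to (⊨-∧ χ χ′) y⊨ in
                         from (⊨-instantiate χ (concat v)) x ∷ h y x′

          satisfiable : FinitelySatisfiable Instances
          satisfiable Δ Δ⊆ =
            let χ , (over , i , g) , h = conjunction Δ⊆
                y , y⊨ = to (⊨-∃ j χ) (v⊨ {∃ᵖ j χ} (Over-∃ j {φ = χ} over , i , λ {w} Wi →
                  let y , Wi′ = extend i Wi in from (⊨-∃ j χ) (y , g Wi′)))
            in  y , h y y⊨

        genericSequence : ∃ λ (g : ℕ → Vec Carrier j) →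
                          ∀ m → Realizes (concat (prefix g m)) (Generic m)
        genericSequence = g , λ m {χ} χ∈ →
          subst (λ v → concat v ⊨ χ) (sym (prefix-chain m)) (proj₂ (chain m) {χ} χ∈)
          where
          chain : ∀ m → ∃ λ v → Realizes (concat v) (Generic m)
          chain zero    = [] , λ { {χ} (_ , i , h) → h (start i) }
          chain (suc m) = let v , v⊨ = chain m
                              y , yv⊨ = extendGeneric v (λ {χ} → v⊨ {χ})
                          in  y ∷ v , λ {χ} → yv⊨ {χ}

          g : ℕ → Vec Carrier j
          g m = Vec.head (proj₁ (chain (suc m)))

          prefix-chain : ∀ m → prefix g m ≡ proj₁ (chain m)
          prefix-chain zero    = refl
          prefix-chain (suc m) = cong (g m ∷_) (prefix-chain m)

    -- Formulas about the entries of a sequence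

    at : ∀ {j i m} → i ℕ.< m → PFormula j → PFormula (m * j)
    at {j} i<m = reindex (combine (proj₁ (position {X = Vec Carrier j} i<m)))

    ⊨-at : ∀ {j i m} (i<m : i ℕ.< m) (g : ℕ → Vec Carrier j) χ →
           concat (prefix g m) ⊨ at i<m χ ⇔ g i ⊨ χ
    ⊨-at {j} {m = m} i<m g χ =
      subst (λ b → concat (prefix g m) ⊨ at i<m χ ⇔ b ⊨ χ) (proj₂ pos g)
        (⊨-reindex (λ i → sym (lookup-concat (prefix g m) (proj₁ pos) i)) χ)
      where pos = position {X = Vec Carrier j} i<m

    -- The parameters of `φ` are turned into the variables of block `s`. Renaming by `_↑ˡ 0` only
    -- presents `φ` as a formula with an empty tuple of parameters.
    conjunct : ∀ {n j m} → Formula L (n + j) → Fin m → PFormula (n + m * j)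
    conjunct {n} φ s = reindex (_⊕_ {n} id (combine s)) (rename (_↑ˡ 0) φ [ [] ])

    ⊨-conjunct : ∀ {n j m} (φ : Formula L (n + j)) (v : Vec (Vec Carrier j) m) s (a : Vec Carrier n) →
                 (a ++ concat v) ⊨ conjunct φ s ⇔ a ⊨ (φ [ lookup v s ])
    ⊨-conjunct φ v s a = mk⇔ (to sat ∘ to re) (from re ∘ from sat)
      where
      re = ⊨-reindex {a = a ++ lookup v s} {a ++ concat v}
        (lookup-⊕ {u = a} {lookup v s} {a} {concat v}
          (λ _ → refl) (λ i → sym (lookup-concat v s i))) (rename (_↑ˡ 0) φ [ [] ])
      sat = Sat-rename M (_↑ˡ 0) {a ++ lookup v s} {(a ++ lookup v s) ++ []}
        (λ i → sym (lookup-++ˡ (a ++ lookup v s) [] i)) φ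

    -- Consistency of the chosen instances becomes a formula without parameters, evaluated at the
    -- concatenated tuples. In this form inconsistency is among the properties that a generic
    -- sequence inherits.
    jointly : ∀ {n j k m} → Formula L (n + j) → (Fin k → Fin m) → PFormula (m * j)
    jointly {n} {k = k} φ q = ∃ᵖ n (⋀ᵖ k (λ t → conjunct {n} φ (q t)))

    Over-jointly : ∀ {n j k m C} (φ : Formula L (n + j)) (q : Fin k → Fin m) →
                   Over C (jointly {n} φ q)
    Over-jointly {n} {k = k} φ q =
      Over-∃ n {φ = ⋀ᵖ k (λ t → conjunct {n} φ (q t))} (Over-⋀ k (λ _ → []))

    ⊨-jointly : ∀ {n j k m} (v : Vec (Vec Carrier j) m) (φ : Formula L (n + j)) (q : Fin k → Fin m) →
                concat v ⊨ jointly {n} φ q ⇔ (∃ λ (a : Vec Carrier n) → ∀ t → a ⊨ (φ [ lookup v (q t) ]))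
    ⊨-jointly {n} {k = k} v φ q = mk⇔
      (λ h → let a , x = to (⊨-∃ n χ) h in
             a , λ t → to (⊨-conjunct φ v (q t) a) (to (⊨-⋀ k (conjunct φ ∘ q)) x t))
      (λ (a , h) → from (⊨-∃ n χ) (a ,
        from (⊨-⋀ k (conjunct φ ∘ q)) (λ t → from (⊨-conjunct φ v (q t) a) (h t))))
      where χ = ⋀ᵖ k (λ t → conjunct {n} φ (q t))

    -- Dividing over a larger set

    module _ (saturated : Saturated) where

      -- Any finitely many formulas are constant on a subsequence of the witness of
      -- dividing over D (pigeonhole), so by compactness some witness is constant
      -- on all formulas over D ∪ E; its terms are the conjugates sought.
      divides-∪ : ∀ {n j} {D : SmallSet} E (φ : Formula L (n + j)) {c : Vec Carrier j} →
                  FormulaDivides (φ [ c ]) D →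
                  ∃ λ c′ → c′ ≡[ D ] c × FormulaDivides (φ [ c′ ]) (D ∪ˢ E)
      divides-∪ {n} {j} {D} E φ {c} (k , bs , bs≡c , incons) =
        g 0 , g≡c , k , g , (λ i → ≡[]-intro (agree i)) , g-incons
        where
        HomogeneousOn : List (PFormula j) → (ℕ → ℕ) → Set (lsuc ℓ)
        HomogeneousOn Γ s = ListAll.All (λ χ → ∀ i i′ → bs (s i) ⊨ χ → bs (s i′) ⊨ χ) Γ

        W : List (PFormula j) → ∀ {m} → Vec (Vec Carrier j) m → Set (lsuc ℓ)
        W Γ {m} v = ∃ λ s → Injective _≡_ _≡_ s × HomogeneousOn Γ s × v ≡ prefix (bs ∘ s) m

        homogeneous : ∀ Γ → ∃ λ s → Injective _≡_ _≡_ s × HomogeneousOn Γ s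
        homogeneous []      = id , id , []
        homogeneous (χ ∷ Γ) =
          let s , s-inj , h = homogeneous Γ
              t , t-inj , h′ = homogeneousSubsequence (λ i → bs (s i) ⊨ χ)
          in  s ∘ t , t-inj ∘ s-inj , h′ ∷ ListAll.map (λ f i i′ → f (t i) (t i′)) h

        sequence : ∃ λ (g : ℕ → Vec Carrier j) → ∀ m {χ} → Over (D ∪ˢ E) χ → ∀ Γ →
          (∀ s → Injective _≡_ _≡_ s → HomogeneousOn Γ s → concat (prefix (bs ∘ s) m) ⊨ χ) →
          concat (prefix g m) ⊨ χ
        sequence =
          let g , g⊨ = genericSequence saturated {C = D ∪ˢ E} W
                (λ Γ Γ′ → Γ List.++ Γ′ , λ (s , s-inj , h , e) →
                  (s , s-inj , ListAllₚ.++⁻ˡ Γ h , e) , (s , s-inj , ListAllₚ.++⁻ʳ Γ h , e))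
                []
                (λ Γ → let s , s-inj , h = homogeneous Γ in s , s-inj , h , refl)
                (λ { Γ {m} (s , s-inj , h , refl) → bs (s m) , s , s-inj , h , refl })
          in  g , λ m {χ} over Γ f →
                g⊨ m {χ} (over , Γ , λ { (s , s-inj , h , refl) → f s s-inj h })

        g = proj₁ sequence
        g-generic = proj₂ sequence

        -- Every term of the witness already satisfies the formulas of `tp c D`, so no homogeneity
        -- is asked for and the list is empty.
        g≡c : g 0 ≡[ D ] c
        g≡c = ≡[]-intro λ χ over c⊨χ → to (⊨-at 0<1 g χ)
          (g-generic 1 {at 0<1 χ} (VecAll.map ∪-inˡ over) [] λ s _ _ →
            from (⊨-at 0<1 (bs ∘ s) χ) (proj₂ (proj₂ (bs≡c (s 0)) {χ} (over , c⊨χ))))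
          where
          0<1 : 0 ℕ.< 1
          0<1 = ℕ.z<s

        -- Along a subsequence homogeneous for `χ`, the formula saying that `χ` holds at entry `0`
        -- and fails at entry `i` is false. Its negation is therefore generic and holds of `g`.
        agree : ∀ i χ → Over (D ∪ˢ E) χ → g 0 ⊨ χ → g i ⊨ χ
        agree i χ over g₀⊨χ = dne λ ¬gᵢ⊨χ → lower (g-generic (suc i) {¬ᵖ (χ₀ ∧ᵖ ¬ᵖ χᵢ)}
          (VecAllₚ.++⁺ over over) (χ ∷ [])
          (λ { s _ (h ∷ []) x →
            let x₀ , ¬xᵢ = to (⊨-∧ {a = concat (prefix (bs ∘ s) (suc i))} χ₀ (¬ᵖ χᵢ)) x
            in  ¬xᵢ (from (⊨-at i<1+i (bs ∘ s) χ) (h 0 i (to (⊨-at 0<1+i (bs ∘ s) χ) x₀))) })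
          (from (⊨-∧ {a = concat (prefix g (suc i))} χ₀ (¬ᵖ χᵢ))
            (from (⊨-at 0<1+i g χ) g₀⊨χ , λ x → ⊥-elim (¬gᵢ⊨χ (to (⊨-at i<1+i g χ) x)))))
          where
          0<1+i : 0 ℕ.< suc i
          0<1+i = ℕ.z<s
          i<1+i : i ℕ.< suc i
          i<1+i = ℕₚ.≤-refl
          χ₀ χᵢ : PFormula (suc i * j)
          χ₀ = at 0<1+i χ
          χᵢ = at i<1+i χ

        -- All chosen entries lie in one prefix. On a subsequence `σ` of the witness the composite
        -- `σ ∘ s` is injective, so the instances there are inconsistent; this is a parameter-free
        -- property and passes to `g`.
        g-incons : Inconsistent k φ g
        g-incons s s-inj (a , a⊨) = lower (g-generic m {¬ᵖ jointly {n} φ q} (Over-jointly {n} φ q) []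
          (λ σ σ-inj _ x → let b , b⊨ = to (⊨-jointly {n} (prefix (bs ∘ σ) m) φ q) x in
             ⊥-elim (incons (σ ∘ s) (s-inj ∘ σ-inj) (b , λ t →
               subst (λ c → b ⊨ (φ [ c ])) (q-position t (bs ∘ σ)) (b⊨ t))))
          (from (⊨-jointly {n} (prefix g m) φ q) (a , λ t →
             subst (λ c → a ⊨ (φ [ c ])) (sym (q-position t g)) (a⊨ t))))
          where
          m = proj₁ (bounded s)
          q : Fin k → Fin m
          q t = proj₁ (position {X = Vec Carrier j} (proj₂ (bounded s) t))
          q-position : ∀ t (g : ℕ → Vec Carrier j) → lookup (prefix g m) (q t) ≡ g (s t)
          q-position t = proj₂ (position {X = Vec Carrier j} (proj₂ (bounded s) t))

    -- Automorphisms and conjugation over a parameter set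

    inverse : Automorphism → Automorphism
    inverse f = record
      { bijection     = ↔-sym bijection
      ; preserves-fun = λ g as → to-injective f (trans (strictlyInverseˡ _) (sym
          (trans (preserves-fun g (Vec.map f.from as)) (cong (⟦ g ⟧ᶠ) (map-to-from f as)))))
      ; preserves-rel = λ r as → mk⇔
          (λ h → from (preserves-rel r (Vec.map f.from as)) (subst ⟦ r ⟧ʳ (sym (map-to-from f as)) h))
          (λ h → subst ⟦ r ⟧ʳ (map-to-from f as) (to (preserves-rel r (Vec.map f.from as)) h))
      }
      where
      module f = Automorphism f
      open f using (bijection; preserves-fun; preserves-rel)
      open Inverse bijection using (strictlyInverseˡ)
      open Structure M using (⟦_⟧ᶠ; ⟦_⟧ʳ)

    -- Strong homogeneity is applied to the family that lists `D` and then `c`: the automorphism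
    -- fixes the first part and moves the second to `c′`.
    conjugating : StronglyHomogeneous → ∀ {j D} {c c′ : Vec Carrier j} → c ≡[ D ] c′ →
      ∃ λ f → (∀ {a} → a ∈ˢ D → Automorphism.to f a ≡ a) × Vec.map (Automorphism.to f) c ≡ c′
    conjugating homogeneous {j} {D} {c} {c′} c≡c′ =
      let f , f-maps = homogeneous (value c) (value c′) same
      in  f , (λ { (i , refl) → f-maps (inj₁ i) })
            , lookup-extensional _ _ (λ i → trans (lookup-map i _ c) (f-maps (inj₂ (lift i))))
      where
      I : Set ℓ
      I = Index D ⊎ Lift ℓ (Fin j)

      value : Vec Carrier j → I → Carrier
      value c = [ elem D , lookup c ∘ lower ]′

      lookup-extensional : ∀ {k} (u v : Vec Carrier k) → (∀ i → lookup u i ≡ lookup v i) → u ≡ v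
      lookup-extensional []      []      h = refl
      lookup-extensional (_ ∷ u) (_ ∷ v) h = cong₂ _∷_ (h zero) (lookup-extensional u v (h ∘ suc))

      -- A formula in elements of `D` and entries of `c` becomes a formula over `D` in `c`. Neither
      -- the parameters `d` nor the map `ρ` depends on `c`, so the same formula serves for `c′`.
      separate : ∀ {k} (is : Vec I k) → ∃ λ l → Σ (Vec Carrier l) λ d → VecAll.All (_∈ˢ D) d ×
        Σ (Fin k → Fin (j + l)) λ ρ → ∀ c i → lookup (Vec.map (value c) is) i ≡ lookup (c ++ d) (ρ i)
      separate [] = 0 , [] , [] , (λ ()) , λ _ ()
      separate (inj₁ x ∷ is) =
        let l , d , d∈D , ρ , h = separate is
        in  suc l , elem D x ∷ d , (x , refl) ∷ d∈D
              , (λ { zero → j ↑ʳ zero ; (suc i) → (_⊕_ {j} id suc) (ρ i) })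
              , (λ { c zero → sym (lookup-++ʳ c (elem D x ∷ d) zero)
                   ; c (suc i) → trans (h c i) (lookup-⊕ {u = c} {d} {c} {elem D x ∷ d}
                       (λ _ → refl) (λ _ → refl) (ρ i)) })
      separate (inj₂ (lift x) ∷ is) =
        let l , d , d∈D , ρ , h = separate is
        in  l , d , d∈D , (λ { zero → x ↑ˡ l ; (suc i) → ρ i })
              , (λ { c zero → sym (lookup-++ˡ c d x) ; c (suc i) → h c i })

      same : ∀ {k} (φ : Formula L k) is → Sat φ (Vec.map (value c) is) ⇔ Sat φ (Vec.map (value c′) is)
      same φ is =
        let l , d , d∈D , ρ , h = separate is
            renamed = λ c → Sat-rename M ρ {Vec.map (value c) is} {c ++ d} (h c) φ
        in  mk⇔
          (λ x → to (renamed c′) (proj₂ (proj₁ c≡c′ {rename ρ φ [ d ]} (d∈D , from (renamed c) x))))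
          (λ x → to (renamed c) (proj₂ (proj₂ c≡c′ {rename ρ φ [ d ]} (d∈D , from (renamed c′) x))))

    -- Monotonicity and invariance of dividing

    formulaDivides-mono : ∀ {n C C′} {φ : PFormula n} → C ⊆ˢ C′ →
                          FormulaDivides φ C′ → FormulaDivides φ C
    formulaDivides-mono C⊆C′ (k , bs , bs≡b , incons) =
      k , bs , (λ i → ≡[]-intro λ χ over b⊨χ →
        proj₂ (proj₂ (bs≡b i) {χ} (VecAll.map C⊆C′ over , b⊨χ))) , incons

    infix 4 _⊢_

    _⊢_ : ∀ {n} → FormulaSet n → FormulaSet n → Set (lsuc ℓ)
    p ⊢ q = ∀ a → Realizes a p → Realizes a q

    divides-mono : ∀ {n C C′} {p q : FormulaSet n} → C ⊆ˢ C′ → q ⊢ p → Divides p C′ → Divides q C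
    divides-mono C⊆C′ q⊢p (φ , div , p⊢φ) =
      φ , formulaDivides-mono {φ = φ} C⊆C′ div , λ a a⊨q → p⊢φ a (q⊢p a a⊨q)

    module _ (f : Automorphism) where
      private module f = Automorphism f

      map-from-to : ∀ {k} (as : Vec Carrier k) → Vec.map f.from (Vec.map f.to as) ≡ as
      map-from-to = map-to-from (inverse f)

      ⊨-pullback⁻ : ∀ {n} {a : Vec Carrier n} φ → Vec.map f.to a ⊨ φ → a ⊨ pullback f φ
      ⊨-pullback⁻ {a = a} φ h = Sat-map⁻ f (formula φ) (subst (Sat (formula φ))
        (sym (trans (map-++ f.to a _) (cong (Vec.map f.to a ++_) (map-to-from f (params φ))))) h)

      realizes-conjugate : ∀ {n} {p : FormulaSet n} {a} → Realizes a p →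
                           Realizes (Vec.map f.to a) (conjugateFormulas f p)
      realizes-conjugate a⊨p {φ} φ∈ = ⊨-pullback f φ (a⊨p φ∈)

      Over-pullback : ∀ {n C C′} {φ : PFormula n} → (∀ {a} → a ∈ˢ C → f.from a ∈ˢ C′) →
                      Over C φ → Over C′ (pullback f φ)
      Over-pullback h = VecAllₚ.map⁺ ∘ VecAll.map h

    module _ (f : Automorphism) where
      private module f = Automorphism f

      realizes-conjugate⁻ : ∀ {n} {p : FormulaSet n} {a} → Realizes a (conjugateFormulas f p) →
                            Realizes (Vec.map f.from a) p
      realizes-conjugate⁻ {p = p} a⊨ {φ} φ∈p = ⊨-pullback (inverse f) φ
        (a⊨ {pullback (inverse f) φ}
          (subst (λ c → p (formula φ [ c ])) (sym (map-from-to f (params φ))) φ∈p))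

      formulaDivides-pullback : ∀ {n C C′} (φ : PFormula n) → (∀ {a} → a ∈ˢ C → f.to a ∈ˢ C′) →
                                FormulaDivides φ C′ → FormulaDivides (pullback f φ) C
      formulaDivides-pullback φ h (k , bs , bs≡b , incons) =
        k , Vec.map f.from ∘ bs
          , (λ i → ≡[]-intro λ χ over x → ⊨-pullback (inverse f) χ
              (proj₂ (proj₂ (bs≡b i) {pullback (inverse f) χ}
                (Over-pullback (inverse f) {φ = χ} h over , ⊨-pullback⁻ (inverse f) χ x))))
          , λ s s-inj (a , a⊨) → incons s s-inj
              (Vec.map f.to a , λ t → ⊨-pullback f (formula φ [ bs (s t) ]) (a⊨ t))

    -- Finite parameter sets, compactness and types of tuples

    fromList-⊆ : ∀ {C as} → ListAll.All (_∈ˢ C) as → fromList as ⊆ˢ C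
    fromList-⊆ as∈C (lift i , refl) = ListAll.lookup as∈C (∈-lookup i)

    parameters : ∀ {n} → List (PFormula n) → List Carrier
    parameters = List.concatMap (Vec.toList ∘ params)

    Over-parameters : ∀ {n} (Δ : List (PFormula n)) → ListAll.All (Over (fromList (parameters Δ))) Δ
    Over-parameters Δ = ListAll.tabulate λ φ∈Δ → VecAllₚ.toList⁻ (ListAll.tabulate λ c∈φ →
      ListAll.lookup (fromList-∈ (parameters Δ)) (∈-concat⁺′ c∈φ (∈-map⁺ (Vec.toList ∘ params) φ∈Δ)))

    parameters-∈ : ∀ {n B} {Δ : List (PFormula n)} → ListAll.All (Over B) Δ →
                   ListAll.All (_∈ˢ B) (parameters Δ)
    parameters-∈ = ListAllₚ.concat⁺ ∘ ListAllₚ.map⁺ ∘ ListAll.map VecAllₚ.toList⁺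

    divides⇒forks : ∀ {n C} {p : FormulaSet n} → Divides p C → Forks p C
    divides⇒forks (φ , div , p⊢φ) = φ ∷ [] , div ∷ [] , λ a a⊨p → here (p⊢φ a a⊨p)

    -- Otherwise `p` with the negation of `φ` is finitely satisfiable, and saturation over `B` and
    -- the parameters of `φ` gives a realization of `p` violating `φ`.
    compactness : Saturated → ∀ {n B} {p : FormulaSet n} → (∀ {φ} → φ ∈ p → Over B φ) →
      ∀ φ → (∀ a → Realizes a p → a ⊨ φ) →
      ∃ λ Δ → ListAll.All (_∈ p) Δ × (∀ a → ListAll.All (a ⊨_) Δ → a ⊨ φ)
    compactness saturated {n} {B} {p} p-over φ p⊢φ = dne λ ¬∃ →
      let a , a⊨ = saturated (B ∪ˢ fromVec (params φ)) p∪¬φ record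
            { over       = λ { (inj₁ ψ∈p) → VecAll.map ∪-inˡ (p-over ψ∈p)
                             ; (inj₂ refl) → VecAll.map ∪-inʳ (fromVec-∈ (params φ)) }
            ; consistent = λ Δ Δ⊆ → let Δ′ , Δ′⊆p , restore = restrict Δ⊆ in
                dne λ ¬sat → ¬∃ (Δ′ , Δ′⊆p , λ a a⊨Δ′ → dne λ ¬a⊨φ →
                  ¬sat (a , restore a a⊨Δ′ (⊥-elim ∘ ¬a⊨φ)))
            }
      in  lower (a⊨ (inj₂ refl) (p⊢φ a (a⊨ ∘ inj₁)))
      where
      p∪¬φ : FormulaSet n
      p∪¬φ ψ = ψ ∈ p ⊎ ψ ≡ ¬ᵖ φ

      restrict : ∀ {Δ} → ListAll.All (_∈ p∪¬φ) Δ → ∃ λ Δ′ → ListAll.All (_∈ p) Δ′ ×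
                 (∀ a → ListAll.All (a ⊨_) Δ′ → a ⊨ (¬ᵖ φ) → ListAll.All (a ⊨_) Δ)
      restrict [] = [] , [] , λ _ _ _ → []
      restrict (inj₁ ψ∈p ∷ Δ⊆) = let Δ′ , Δ′⊆p , restore = restrict Δ⊆ in
        _ ∷ Δ′ , ψ∈p ∷ Δ′⊆p , λ { a (x ∷ xs) y → x ∷ restore a xs y }
      restrict (inj₂ refl ∷ Δ⊆) = let Δ′ , Δ′⊆p , restore = restrict Δ⊆ in
        Δ′ , Δ′⊆p , λ a xs y → y ∷ restore a xs y

    completeType : ∀ {n} → Vec Carrier n → SmallSet → CompleteType n
    completeType a C = record
      { dom            = C
      ; formulas       = tp a C
      ; isCompleteType = record
        { isPartialType = record
          { over       = proj₁
          ; consistent = λ Δ Δ⊆ → a , ListAll.map proj₂ Δ⊆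
          }
        ; complete = λ {φ} → decide φ
        }
      }
      where
      decide : ∀ φ → Over C φ → φ ∈ tp a C ⊎ (¬ᵖ φ) ∈ tp a C
      decide φ φ-over with em {P = a ⊨ φ}
      ... | yes a⊨φ = inj₁ (φ-over , a⊨φ)
      ... | no ¬a⊨φ = inj₂ (φ-over , ⊥-elim ∘ ¬a⊨φ)

    -- As a complete type, `q` decides the formula `c = c`, and consistency rules out its negation;
    -- so the formula passes to `r`, whose parameters lie in its domain.
    ⊑⇒dom-⊆ : ∀ {n} {q r : CompleteType n} → q ⊑ r → dom q ⊆ˢ dom r
    ⊑⇒dom-⊆ {n} {q} {r} q⊑r {c} c∈q with CompleteType.complete q {c≐c} (c∈q ∷ [])
      where
      c≐c : PFormula n
      c≐c = (var (n ↑ʳ zero) ≐ᶠ var (n ↑ʳ zero)) [ c ∷ [] ]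
    ... | inj₁ c≐c∈q = VecAll.head (CompleteType.over r (q⊑r c≐c∈q))
    ... | inj₂ c≠c∈q with CompleteType.consistent q _ (c≠c∈q ∷ [])
    ...   | _ , c≠c ∷ [] = ⊥-elim (lower (c≠c refl))

    -- States, their dividing order, its foundation rank and conjugation

    record State (n : ℕ) : Set (lsuc (lsuc ℓ)) where
      no-eta-equality
      field
        base    : SmallSet
        type    : FormulaSet n
        over    : ∀ {φ} → φ ∈ type → Over base φ
        witness : ∃ λ a → Realizes a type

    open State

    infix 4 _≼_ _◁_ _⪰[_]_

    record _≼_ {n} (t s : State n) : Set (lsuc ℓ) where
      constructor refinement
      field
        base-⊆ : base s ⊆ˢ base t
        type-⊢ : type t ⊢ type s

    record _◁_ {n} (t s : State n) : Set (lsuc ℓ) where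
      constructor dividing
      field
        refines : t ≼ s
        divides : Divides (type t) (base s)

    open _≼_
    open _◁_

    ≼-refl : ∀ {n} {s : State n} → s ≼ s
    ≼-refl = refinement id (λ _ a⊨ → a⊨)

    ≼-trans : ∀ {n} {s t u : State n} → u ≼ t → t ≼ s → u ≼ s
    ≼-trans u≼t t≼s = refinement (base-⊆ u≼t ∘ base-⊆ t≼s)
      (λ a a⊨u → type-⊢ t≼s a (type-⊢ u≼t a a⊨u))

    ◁-≼-trans : ∀ {n} {s t u : State n} → u ◁ t → t ≼ s → u ◁ s
    ◁-≼-trans (dividing u≼t div) t≼s =
      dividing (≼-trans u≼t t≼s) (divides-mono (base-⊆ t≼s) (λ _ a⊨ → a⊨) div)

    acc-≼ : ∀ {n} {s t : State n} → t ≼ s → Acc _◁_ s → Acc _◁_ t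
    acc-≼ t≼s (acc h) = acc λ u◁t → h (◁-≼-trans u◁t t≼s)

    foundationRank : ∀ {n} {s : State n} → Acc _◁_ s → Ordinal
    foundationRank {s = s} (acc h) = sup⁺ {I = ∃ λ t → t ◁ s} λ (_ , t◁s) → foundationRank (h t◁s)

    -- Any state dividing below `t` divides below `s`, so the supremum for `s` ranges over at least
    -- as much. For `s = t` this makes the rank independent of the accessibility proof, up to `≈`.
    foundationRank-≼ : ∀ {n} {s t : State n} → t ≼ s →
                       (x : Acc _◁_ s) (y : Acc _◁_ t) → foundationRank y ≤ foundationRank x
    foundationRank-≼ t≼s (acc h) (acc k) (u , u◁t) =
      (u , u◁s) , foundationRank-≼ ≼-refl (h u◁s) (k u◁t)
      where u◁s = ◁-≼-trans u◁t t≼s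

    foundationRank-◁ : ∀ {n} {s t : State n} → t ◁ s → (x : Acc _◁_ s) (y : Acc _◁_ t) →
                       foundationRank y < foundationRank x
    foundationRank-◁ t◁s (acc h) y = (_ , t◁s) , foundationRank-≼ ≼-refl (h t◁s) y

    -- This is refinement of the `f`-conjugate of `s` by `t`. Phrased with elements and
    -- realizations, it never compares a state with the result of conjugating it back and forth.
    record _⪰[_]_ {n} (s : State n) (f : Automorphism) (t : State n) : Set (lsuc ℓ) where
      constructor embedding
      field
        base-to   : ∀ {a} → a ∈ˢ base s → Automorphism.to f a ∈ˢ base t
        type-from : ∀ a → Realizes a (type t) → Realizes (Vec.map (Automorphism.from f) a) (type s)

    open _⪰[_]_

    conjugateState : ∀ {n} → Automorphism → State n → State n
    conjugateState f s = record
      { base    = image f (base s)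
      ; type    = conjugateFormulas f (type s)
      ; over    = λ {φ} φ∈ → subst (VecAll.All (_∈ˢ image f (base s))) (map-to-from f (params φ))
                    (VecAllₚ.map⁺ (VecAll.map (∈-image f) (over s φ∈)))
      ; witness = let a , a⊨ = witness s in _ , λ {φ} → realizes-conjugate f {p = type s} a⊨ {φ}
      }

    conjugateState-⪰ : ∀ {n} f (s : State n) → conjugateState (inverse f) s ⪰[ f ] s
    conjugateState-⪰ f s = embedding (∈-image⁻ (inverse f) {base s})
      (λ a a⊨ {φ} → realizes-conjugate (inverse f) {p = type s} a⊨ {φ})

    -- Since `f` maps `base s` into `base t`, a formula dividing over `base t` is pulled back along
    -- `f` to one dividing over `base s`.
    ⪰-◁ : ∀ {n} {f} {s t t′ : State n} → s ⪰[ f ] t → t′ ◁ t →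
          conjugateState (inverse f) t′ ◁ s
    ⪰-◁ {f = f} {s} {t} {t′} s⪰t (dividing t′≼t (φ , div , t′⊢φ)) = dividing
      (refinement
        (λ a∈s → subst (_∈ˢ image (inverse f) (base t′)) (strictlyInverseʳ _)
          (∈-image (inverse f) {base t′} (base-⊆ t′≼t (base-to s⪰t a∈s))))
        (λ a a⊨ → subst (λ b → Realizes b (type s)) (map-from-to f a)
          (type-from s⪰t _ (type-⊢ t′≼t _ (from-conjugate a (λ {φ} → a⊨ {φ}))))))
      (pullback f φ , formulaDivides-pullback f φ (base-to s⪰t) div
        , λ a a⊨ → ⊨-pullback⁻ f φ (t′⊢φ _ (from-conjugate a (λ {φ} → a⊨ {φ}))))
      where
      open Inverse (Automorphism.bijection f) using (strictlyInverseʳ)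
      from-conjugate : ∀ a → Realizes a (conjugateFormulas (inverse f) (type t′)) →
                       Realizes (Vec.map (Automorphism.to f) a) (type t′)
      from-conjugate a a⊨ = realizes-conjugate⁻ (inverse f) {p = type t′} (λ {φ} → a⊨ {φ})

    acc-⪰ : ∀ {n} {f} {s t : State n} → s ⪰[ f ] t → Acc _◁_ s → Acc _◁_ t
    acc-⪰ {f = f} s⪰t (acc h) = acc λ {t′} t′◁t →
      acc-⪰ (conjugateState-⪰ f t′) (h (⪰-◁ s⪰t t′◁t))

    foundationRank-⪰ : ∀ {n} {f} {s t : State n} → s ⪰[ f ] t →
                       (x : Acc _◁_ s) (y : Acc _◁_ t) → foundationRank y ≤ foundationRank x
    foundationRank-⪰ {f = f} s⪰t (acc h) (acc k) (t′ , t′◁t) =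
      (_ , s′◁s) , foundationRank-⪰ (conjugateState-⪰ f t′) (h s′◁s) (k t′◁t)
      where s′◁s = ⪰-◁ s⪰t t′◁t

    -- Adding a formula to a state

    adjoin : ∀ {n} (s : State n) E φ → Over E φ →
             (∃ λ a → Realizes a (type s) × a ⊨ φ) → State n
    adjoin s E φ φ-over (a , a⊨s , a⊨φ) = record
      { base    = base s ∪ˢ E
      ; type    = λ ψ → ψ ∈ type s ⊎ ψ ≡ φ
      ; over    = λ { (inj₁ ψ∈s) → VecAll.map ∪-inˡ (over s ψ∈s)
                    ; (inj₂ refl) → VecAll.map ∪-inʳ φ-over }
      ; witness = a , λ { (inj₁ ψ∈s) → a⊨s ψ∈s ; (inj₂ refl) → a⊨φ }
      }

    -- Such `t` are the states below `adjoin s E φ`, but no common realization of `type s` and `φ`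
    -- is presupposed; if there is none, no state forces `φ`.
    record Forces {n} (s : State n) (E : SmallSet) (φ : PFormula n) (t : State n) : Set (lsuc ℓ) where
      constructor forcing
      field
        base-⊇  : (base s ∪ˢ E) ⊆ˢ base t
        type-⊢′ : type t ⊢ type s
        forces  : ∀ a → Realizes a (type t) → a ⊨ φ

    open Forces

    adjoin-forces : ∀ {n} (s : State n) E φ φ-over sat → Forces s E φ (adjoin s E φ φ-over sat)
    adjoin-forces s E φ φ-over sat = forcing id (λ a a⊨ → a⊨ ∘ inj₁) (λ a a⊨ → a⊨ (inj₂ refl))

    adjoin-greatest : ∀ {n} {s t : State n} {E φ φ-over sat} → Forces s E φ t → t ≼ adjoin s E φ φ-over sat
    adjoin-greatest forced = refinement (base-⊇ forced) λ a a⊨t →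
      λ { (inj₁ ψ∈s) → type-⊢′ forced a a⊨t ψ∈s ; (inj₂ refl) → forces forced a a⊨t }

    -- Extension property of the foundation rank

    module _ (saturated : Saturated) (homogeneous : StronglyHomogeneous) where

      -- The parameters of the dividing formula are replaced by conjugates over `base s` for which
      -- it divides over `base s ∪ˢ E`; a homogeneity automorphism carries `t` along.
      spread : ∀ {n} E {s t : State n} → t ◁ s → ∃ λ f →
        conjugateState f t ◁ s × Divides (type (conjugateState f t)) (base s ∪ˢ E)
      spread {n} E {s} {t} (dividing t≼s (φ , div , t⊢φ)) = f , dividing
        (refinement
          -- `f` fixes `base s` pointwise, hence also the parameters of `type s`; so the conjugate
          -- of `t` still refines `s`.
          (λ a∈s → subst (_∈ˢ image f (base t)) (fixes a∈s) (∈-image f {base t} (base-⊆ t≼s a∈s)))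
          (λ a a⊨ {χ} χ∈s → subst (λ d → a ⊨ (formula χ [ d ])) (map-fixes (over s χ∈s))
            (⊨-pullback⁻ (inverse f) χ (type-⊢ t≼s _ (from-conjugate a (λ {ψ} → a⊨ {ψ})) χ∈s))))
        (φ′ , formulaDivides-mono {φ = φ′} ∪-inˡ divφ′ , ft⊢φ′)
        , φ′ , divφ′ , ft⊢φ′
        where
        moved = divides-∪ saturated {D = base s} E (formula φ) div
        c≡c′ : params φ ≡[ base s ] proj₁ moved
        c≡c′ = (λ {χ} → proj₂ (proj₁ (proj₂ moved)) {χ}) , (λ {χ} → proj₁ (proj₁ (proj₂ moved)) {χ})
        conj = conjugating homogeneous {D = base s} c≡c′
        f = proj₁ conj
        fixes = proj₁ (proj₂ conj)

        φ′ : PFormula n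
        φ′ = pullback (inverse f) φ

        divφ′ : FormulaDivides φ′ (base s ∪ˢ E)
        divφ′ = subst (λ c → FormulaDivides (formula φ [ c ]) (base s ∪ˢ E))
          (sym (proj₂ (proj₂ conj))) (proj₂ (proj₂ moved))

        from-conjugate : ∀ a → Realizes a (conjugateFormulas f (type t)) →
                         Realizes (Vec.map (Automorphism.from f) a) (type t)
        from-conjugate a a⊨ = realizes-conjugate⁻ f {p = type t} (λ {ψ} → a⊨ {ψ})

        ft⊢φ′ : ∀ a → Realizes a (conjugateFormulas f (type t)) → a ⊨ φ′
        ft⊢φ′ a a⊨ = ⊨-pullback⁻ (inverse f) φ (t⊢φ _ (from-conjugate a (λ {ψ} → a⊨ {ψ})))

        map-fixes : ∀ {k} {v : Vec Carrier k} → VecAll.All (_∈ˢ base s) v →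
                    Vec.map (Automorphism.to f) v ≡ v
        map-fixes []        = refl
        map-fixes (a∈ ∷ v∈) = cong₂ _∷_ (fixes a∈) (map-fixes v∈)

      -- If t ◁ s by θ, then θ may not divide over the parameters E of Δ; replacing t
      -- by a conjugate over base s repairs this without changing its rank.
      foundationRank-cover : ∀ {n} {E} {Δ : List (PFormula n)} → ListAll.All (Over E) Δ →
        ∀ {s} (x : Acc _◁_ s) → (∀ a → Realizes a (type s) → ListAny.Any (a ⊨_) Δ) → ∀ {α} →
        ListAll.All (λ φ → ∀ {t} → Forces s E φ t → (y : Acc _◁_ t) → foundationRank y < α) Δ →
        foundationRank x < α
      foundationRank-cover {n} {E} {Δ} Δ-over {s} (acc h) cover {sup⁺ g} bounds =
        -- The rank of `s` is the least strict bound of the ranks below it, so it suffices that each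
        -- of these is below one branch `g j` of the bound.
        j , sup⁺-≤ λ (t , t◁s) → below t t◁s
        where
        x : Acc _◁_ s
        x = acc h

        Bounded : PFormula n → Ordinal → Set (lsuc (lsuc ℓ))
        Bounded φ β = ∀ {t} → Forces s E φ t → (y : Acc _◁_ t) → foundationRank y ≤ β

        -- `adjoin s E φ` is the greatest state forcing `φ`, so a bound for its rank bounds the
        -- ranks of all the others.
        index : ∀ {φ} → Over E φ → (∃ λ a → Realizes a (type s) × a ⊨ φ) →
                (∀ {t} → Forces s E φ t → (y : Acc _◁_ t) → foundationRank y < sup⁺ g) →
                ∃ λ j → Bounded φ (g j)
        index {φ} φ-over sat bound =
          let forced = adjoin-forces s E φ φ-over sat
              y = acc-≼ (refinement (base-⊇ forced ∘ ∪-inˡ) (type-⊢′ forced)) x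
              j , y≤gⱼ = bound forced y
          in  j , λ forced′ z → ≤-trans
                (foundationRank-≼ (adjoin-greatest {φ-over = φ-over} {sat} forced′) y z) y≤gⱼ

        -- A realization of `s` satisfies some member of `Δ`, so this index exists. It is the
        -- default for members inconsistent with `s`, whose bound holds vacuously.
        j₀ = let a , a⊨s = witness s
                 any = cover a a⊨s
                 i = ListAny.index any
             in  proj₁ (index (ListAll.lookup Δ-over (∈-lookup i))
                   (a , a⊨s , lookup-index any) (ListAll.lookup bounds (∈-lookup i)))

        indices : ListAll.All (λ φ → ∃ λ j → Bounded φ (g j)) Δ
        indices = ListAll.zipWith choose (Δ-over , bounds)
          where
          choose : ∀ {φ} → Over E φ ×
                   (∀ {t} → Forces s E φ t → (y : Acc _◁_ t) → foundationRank y < sup⁺ g) →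
                   ∃ λ j → Bounded φ (g j)
          choose {φ} (φ-over , bound) with em {P = ∃ λ a → Realizes a (type s) × a ⊨ φ}
          ... | yes sat = index φ-over sat bound
          ... | no ¬sat = j₀ , λ {t} forced _ → let a , a⊨t = witness t in
            ⊥-elim (¬sat (a , type-⊢′ forced a a⊨t , forces forced a a⊨t))

        common : ∃ λ j → ListAll.All (λ φ → Bounded φ (g j)) Δ
        common = commonBound {Q = Bounded} (λ β≤γ b forced y → ≤-trans (b forced y) β≤γ) j₀ indices

        j = proj₁ common

        -- The conjugate of `t` has at least the rank of `t` and is covered by the same `Δ`. The
        -- induction hypothesis applies to it with the smaller bound `g j`.
        below-spread : ∀ t (t◁s : t ◁ s) f → conjugateState f t ◁ s →
          Divides (type (conjugateState f t)) (base s ∪ˢ E) → foundationRank (h t◁s) < g j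
        below-spread t t◁s f ft◁s ft-div = ≤-<-trans
          (foundationRank-⪰ {f = inverse f} (embedding (∈-image⁻ f {base t})
            (λ a a⊨ {φ} → realizes-conjugate f {p = type t} a⊨ {φ})) (h ft◁s) (h t◁s))
          (foundationRank-cover Δ-over (h ft◁s)
            (λ a a⊨ → cover a (type-⊢ (refines ft◁s) a (λ {φ} → a⊨ {φ})))
            (ListAll.zipWith forced-below (Δ-over , proj₂ common)))
          where
          forced-below : ∀ {φ} → Over E φ × Bounded φ (g j) → ∀ {u} →
                         Forces (conjugateState f t) E φ u → (y : Acc _◁_ u) → foundationRank y < g j
          forced-below {φ} (φ-over , bound) {u} forced y =
            <-≤-trans (foundationRank-◁ u◁sφ sφ y) (bound (adjoin-forces s E φ φ-over sat) sφ)
            where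
            u⊢s : type u ⊢ type s
            u⊢s a a⊨u = type-⊢ (refines ft◁s) a (λ {ψ} → type-⊢′ forced a a⊨u {ψ})

            sat : ∃ λ a → Realizes a (type s) × a ⊨ φ
            sat = let a , a⊨u = witness u in a , u⊢s a a⊨u , forces forced a a⊨u

            sφ : Acc _◁_ (adjoin s E φ φ-over sat)
            sφ = acc-≼ (refinement ∪-inˡ (λ a a⊨ → a⊨ ∘ inj₁)) x

            -- The conjugate of `t` divides over `base s ∪ˢ E`, which is the base of the adjoined
            -- state; dividing over `base s` alone would not do.
            u◁sφ : u ◁ adjoin s E φ φ-over sat
            u◁sφ = dividing
              (adjoin-greatest {s = s} {E = E} {φ} {φ-over} {sat} (forcing
                (λ { (inj₁ i , e) → base-⊇ forced (∪-inˡ (base-⊆ (refines ft◁s) (i , e)))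
                   ; (inj₂ i , e) → base-⊇ forced (inj₂ i , e) })
                u⊢s (forces forced)))
              (divides-mono id (type-⊢′ forced) ft-div)

        below : ∀ t (t◁s : t ◁ s) → foundationRank (h t◁s) < g j
        below t t◁s = let f , ft◁s , ft-div = spread E t◁s in below-spread t t◁s f ft◁s ft-div

      -- Supersimplicity gives well-foundedness

      supersimple⇒acc : ∀ {n} (s : State n) → Supersimple (base s) (type s) → Acc _◁_ s
      supersimple⇒acc {n} s supersimple = dne refute
        where
        descend : ∀ {t} → ¬ Acc _◁_ t → ∃ λ u → u ◁ t × ¬ Acc _◁_ u
        descend {t} ¬acc = dne λ ¬∃ → ¬acc (acc λ {u} u◁t → dne λ ¬acc-u → ¬∃ (u , u◁t , ¬acc-u))

        module _ (¬acc : ¬ Acc _◁_ s) where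
          chain : ℕ → ∃ λ t → ¬ Acc _◁_ t
          chain zero    = s , ¬acc
          chain (suc i) = let t , _ , ¬acc-t = descend (proj₂ (chain i)) in t , ¬acc-t

          state : ℕ → State n
          state i = proj₁ (chain i)

          state-◁ : ∀ i → state (suc i) ◁ state i
          state-◁ i = proj₁ (proj₂ (descend (proj₂ (chain i))))

          state-≼ : ∀ {i k} → i ℕ.≤′ k → state k ≼ state i
          state-≼ ℕ.≤′-refl           = ≼-refl
          state-≼ (ℕ.≤′-step {k} i≤k) = ≼-trans (refines (state-◁ k)) (state-≼ i≤k)

          B : SmallSet
          B = record { Index = Σ ℕ (Index ∘ base ∘ state) ; elem = λ (i , x) → elem (base (state i)) x }

          base⊆B : ∀ i → base (state i) ⊆ˢ B
          base⊆B i (x , e) = (i , x) , e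

          limit : FormulaSet n
          limit φ = ∃ λ i → φ ∈ type (state i)

          -- Finitely many formulas of the union are all implied by one state of the chain, whose
          -- witness satisfies them.
          realized : ∃ λ a → Realizes a limit
          realized = saturated B limit record
            { over       = λ (i , φ∈) → VecAll.map (base⊆B i) (over (state i) φ∈)
            ; consistent = λ Δ Δ⊆ →
                let m , forced = eventually {P = λ i φ → ∀ a → Realizes a (type (state i)) → a ⊨ φ}
                      (λ i≤k h a a⊨ → h a (type-⊢ (state-≼ (ℕₚ.≤⇒≤′ i≤k)) a a⊨))
                      (ListAll.map (λ (i , φ∈) → i , λ a a⊨ → a⊨ φ∈) Δ⊆)
                    a , a⊨ = witness (state m)
                in  a , ListAll.map (λ h → h a a⊨) forced
            }

          refute : ⊥
          refute =
            let a , a⊨ = realized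
                B₀ , B₀⊆B , ¬div = supersimple B (base⊆B 0) a (a⊨ ∘ (0 ,_))
                -- Some base of the chain contains the finite set `B₀`. The type of `a` over `B`
                -- contains the type of the next state, which divides over that base, hence over
                -- `base s` together with `B₀`.
                m , B₀⊆m = eventually {P = λ i b → b ∈ˢ base (state i)}
                  (λ i≤k → base-⊆ (state-≼ (ℕₚ.≤⇒≤′ i≤k)))
                  (ListAll.map (λ { ((i , x) , e) → i , x , e }) B₀⊆B)
            in  ¬div (divides-mono
                  (λ { (inj₁ x , e) → base-⊆ (state-≼ (ℕₚ.≤⇒≤′ (ℕ.z≤n {m}))) (x , e)
                     ; (inj₂ x , e) → fromList-⊆ B₀⊆m (x , e) })
                  (λ b b⊨ {φ} φ∈ → b⊨ {φ}
                    (VecAll.map (base⊆B (suc m)) (over (state (suc m)) φ∈) , a⊨ (suc m , φ∈)))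
                  (divides (state-◁ m)))

      -- The foundation rank on complete types

      stateOf : ∀ {n} → CompleteType n → State n
      stateOf q = record
        { base    = dom q
        ; type    = formulas q
        ; over    = CompleteType.over q
        ; witness = saturated (dom q) (formulas q) (CompleteType.isPartialType q)
        }

      ⊑⇒≼ : ∀ {n} {q r : CompleteType n} → q ⊑ r → stateOf r ≼ stateOf q
      ⊑⇒≼ {q = q} {r} q⊑r = refinement (⊑⇒dom-⊆ {q = q} {r} q⊑r) (λ a a⊨r → a⊨r ∘ q⊑r)

      stateOf-⪰ : ∀ {n} f (q : CompleteType n) → stateOf q ⪰[ f ] stateOf (conjugate f q)
      stateOf-⪰ f q = embedding (∈-image f {dom q})
        (λ a a⊨ → realizes-conjugate⁻ f {p = formulas q} (λ {φ} → a⊨ {φ}))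

      stateOf-⪰⁻ : ∀ {n} f (q : CompleteType n) → stateOf (conjugate f q) ⪰[ inverse f ] stateOf q
      stateOf-⪰⁻ f q = embedding (∈-image⁻ f {dom q})
        (λ a a⊨ {φ} → realizes-conjugate f {p = formulas q} a⊨ {φ})

      module _ {n} (A : SmallSet) (p : FormulaSet n) (p-type : IsPartialType A p) where

        open Rank using (rank)

        initial : State n
        initial = record
          { base    = A
          ; type    = p
          ; over    = IsPartialType.over p-type
          ; witness = saturated A p p-type
          }

        -- Completions and extensions refine an accessible state, and conjugates are reached by `⪰`;
        -- accessibility passes along both.
        acc-⟨⟩ : Acc _◁_ initial → ∀ {m} {q : CompleteType m} → q ∈ ⟨ A ∣ p ⟩ → Acc _◁_ (stateOf q)
        acc-⟨⟩ x (completion p⊆q c)             = acc-≼ (refinement id (λ a a⊨q → a⊨q ∘ p⊆q)) x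
        acc-⟨⟩ x (extension {q = q} {r} q∈ q⊑r) = acc-≼ (⊑⇒≼ {q = q} {r} q⊑r) (acc-⟨⟩ x q∈)
        acc-⟨⟩ x (conjugation {q = q} f q∈)     = acc-⪰ (stateOf-⪰ f q) (acc-⟨⟩ x q∈)

        dividingFoundationRank : Acc _◁_ initial → Rank ⟨ A ∣ p ⟩
        dividingFoundationRank x = record
          { rank        = λ _ q∈ → Sup.[ foundationRank (acc-⟨⟩ x q∈) ]
          ; heredity    = λ {_} {q} {r} q∈ r∈ q⊑r →
              NonStrict⁺.[ foundationRank-≼ (⊑⇒≼ {q = q} {r} q⊑r) (acc-⟨⟩ x q∈) (acc-⟨⟩ x r∈) ]
          ; isomorphism = λ {_} {q} f q∈ qᶠ∈ → Equality⁺.[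
                foundationRank-⪰ (stateOf-⪰⁻ f q) (acc-⟨⟩ x qᶠ∈) (acc-⟨⟩ x q∈)
              , foundationRank-⪰ (stateOf-⪰ f q) (acc-⟨⟩ x q∈) (acc-⟨⟩ x qᶠ∈) ]
          }

        -- A state that forces a member of `Δ` on the larger type refines the smaller one and
        -- divides over its domain, so it has lower rank; the cover property carries this bound to
        -- the larger type itself.
        dividingFoundationRank-forking : ∀ x → IsForkingRank (dividingFoundationRank x)
        dividingFoundationRank-forking x {p = q} {r} q∈ r∈ q⊑r _ (Δ , divs , cover) = Strict⁺.[
          foundationRank-cover (Over-parameters Δ) (acc-⟨⟩ x r∈) cover
            (ListAll.map (λ {φ} div {_} forced → foundationRank-◁ (dividing
              (≼-trans (refinement (base-⊇ forced ∘ ∪-inˡ) (type-⊢′ forced)) (⊑⇒≼ {q = q} {r} q⊑r))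
              (φ , div , forces forced)) (acc-⟨⟩ x q∈)) divs) ]

        supersimple⇒forkingRank : Supersimple A p →
          Σ TypeFamily λ 𝔄 → IsClass 𝔄 × Σ (Rank 𝔄) λ R → IsForkingRank R × RanksAll R ⟨ A ∣ p ⟩
        supersimple⇒forkingRank supersimple =
          ⟨ A ∣ p ⟩ , record { extension = extension ; conjugation = conjugation } ,
          dividingFoundationRank x , dividingFoundationRank-forking x , λ q∈ → q∈ , Strict⁺.[ _ ]<⊤⁺
          where x = supersimple⇒acc initial supersimple

        -- From a dividing rank to supersimplicity

        dividingRank⇒supersimple :
          (Σ TypeFamily λ 𝔄 → IsClass 𝔄 × Σ (Rank 𝔄) λ R → IsDividingRank R × RanksAll R ⟨ A ∣ p ⟩) →
          Supersimple A p
        dividingRank⇒supersimple (𝔄 , _ , R , R-dividing , ranks) B A⊆B a a⊨p = dne λ ¬∃ →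
          -- The descent starts from the empty `B₀`, whose type is ranked and hence bounded by an
          -- ordinal.
          let α , ≤α = <⊤⁺⇒≤⁺ (proj₂ (ranks (q∈ []))) in descent ¬∃ α [] [] ≤α
          where
          q : List Carrier → CompleteType n
          q B₀ = completeType a (A ∪ˢ fromList B₀)

          q∈ : ∀ B₀ → q B₀ ∈ ⟨ A ∣ p ⟩
          q∈ B₀ = extension (completion (λ φ∈p → IsPartialType.over p-type φ∈p , a⊨p φ∈p)
            (CompleteType.isCompleteType (completeType a A)))
            (λ (φ-over , a⊨φ) → VecAll.map ∪-inˡ φ-over , a⊨φ)

          -- A rank may depend on the proof of membership, so the one supplied by `ranks` is used
          -- throughout.
          rankOf : List Carrier → Ordinal ⁺
          rankOf B₀ = rank R (q B₀) (proj₁ (ranks (q∈ B₀)))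

          -- By compactness finitely many formulas of `tp a B` imply the dividing formula. Once
          -- their parameters are added to `B₀`, the type of `a` over `A` and the enlarged set
          -- divides over `A ∪ˢ fromList B₀`.
          enlarge : ∀ B₀ → ListAll.All (_∈ˢ B) B₀ → Divides (tp a B) (A ∪ˢ fromList B₀) →
            ∃ λ B₁ → ListAll.All (_∈ˢ B) B₁ × rankOf B₁ <⁺ rankOf B₀
          enlarge B₀ B₀⊆B (φ , div , a/B⊢φ) =
            let Δ , Δ⊆ , Δ⊢φ = compactness saturated proj₁ φ a/B⊢φ
                B₁ = B₀ List.++ parameters Δ
            in  B₁ , ListAllₚ.++⁺ B₀⊆B (parameters-∈ (ListAll.map proj₁ Δ⊆))
                   , R-dividing _ _
                       (λ (χ-over , a⊨χ) → VecAll.map (enlarged (parameters Δ)) χ-over , a⊨χ)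
                       (proj₂ (ranks (q∈ B₀)))
                       (φ , div , λ b b⊨ → Δ⊢φ b (ListAll.zipWith
                         (λ {χ} (χ-over , (_ , a⊨χ)) → b⊨ {χ} (VecAll.map
                           (∪-inʳ ∘ fromList-⊆ (ListAllₚ.++⁻ʳ B₀ (fromList-∈ B₁))) χ-over , a⊨χ))
                         (Over-parameters Δ , Δ⊆)))
            where
            enlarged : ∀ bs → (A ∪ˢ fromList B₀) ⊆ˢ (A ∪ˢ fromList (B₀ List.++ bs))
            enlarged bs (inj₁ x , e) = inj₁ x , e
            enlarged bs (inj₂ x , e) =
              ∪-inʳ (fromList-⊆ (ListAllₚ.++⁻ˡ B₀ (fromList-∈ (B₀ List.++ bs))) (x , e))

          -- Recursion on an ordinal bound for the rank: were every `B₀` to fail, each enlargement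
          -- would move the bound to a branch of `sup⁺ g`.
          descent : ¬ (∃ λ B₀ → ListAll.All (_∈ˢ B) B₀ × ¬ Divides (tp a B) (A ∪ˢ fromList B₀)) →
                    ∀ α B₀ → ListAll.All (_∈ˢ B) B₀ → rankOf B₀ ≤⁺ Sup.[ α ] → ⊥
          descent ¬∃ (sup⁺ g) B₀ B₀⊆B ≤α =
            let B₁ , B₁⊆B , B₁<B₀ = enlarge B₀ B₀⊆B (dne λ ¬div → ¬∃ (B₀ , B₀⊆B , ¬div))
                j , ≤gⱼ = <⁺-≤⁺-sup⁺ B₁<B₀ ≤α
            in  descent ¬∃ (g j) B₁ B₁⊆B ≤gⱼ

corollary2p29 : (∀ {a} → ExcludedMiddle a) →
    ∀ {ℓ : Level} {L : Language ℓ} (T : Theory L) → CompleteTheory T →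
    (ℭ : MonsterModel T) → let open Types (MonsterModel.structure ℭ) in
    ∀ {n : ℕ} (A : SmallSet) (p : FormulaSet n) → IsPartialType A p →
    (Supersimple A p ⇔
    (Σ TypeFamily λ 𝔄 → IsClass 𝔄 × Σ (Rank 𝔄) λ R → IsForkingRank R × RanksAll R ⟨ A ∣ p ⟩))
    ×
    (Supersimple A p ⇔
    (Σ TypeFamily λ 𝔄 → IsClass 𝔄 × Σ (Rank 𝔄) λ R → IsDividingRank R × RanksAll R ⟨ A ∣ p ⟩))
corollary2p29 em T _ ℭ A p p-type =
  mk⇔ a⇒b (c⇒a ∘ b⇒c) , mk⇔ (b⇒c ∘ a⇒b) c⇒a
  where
  open MonsterModel ℭ
  open Types structure
  open Classical em structure

  a⇒b = supersimple⇒forkingRank saturated stronglyHomogeneous A p p-type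
  c⇒a = dividingRank⇒supersimple saturated stronglyHomogeneous A p p-type

  -- Dividing is forking with a single disjunct, so the same rank serves.
  b⇒c : (Σ TypeFamily λ 𝔄 → IsClass 𝔄 × Σ (Rank 𝔄) λ R → IsForkingRank R × RanksAll R ⟨ A ∣ p ⟩) →
        (Σ TypeFamily λ 𝔄 → IsClass 𝔄 × Σ (Rank 𝔄) λ R → IsDividingRank R × RanksAll R ⟨ A ∣ p ⟩)
  b⇒c (𝔄 , 𝔄-class , R , R-forking , ranks) =
    𝔄 , 𝔄-class , R , (λ p∈ q∈ p⊑q ranked div → R-forking p∈ q∈ p⊑q ranked (divides⇒forks div)) , ranks
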